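{- Let $k\ge 1$. Every $k$-strategy $\Sigma$ determines, for every set $\mathcal{P}$ of $k$-profiles in a graph $G$, a canonical nested separation system $N_\Sigma(G,\mathcal{P})$ consisting of $\mathcal{P}$-essential separations of $G$ of order $<k$ that distinguishes all the profiles in $\mathcal{P}$ efficiently. That is: the recursion defining $N_\Sigma(G,\mathcal{P})$ succeeds; $N_\Sigma(G,\mathcal{P})$ is a nested separation system all of whose elements are $\mathcal{P}$-essential and have order $<k$; for every two distinct $P,P'\in\mathcal{P}$ some separation in $N_\Sigma(G,\mathcal{P})$ distinguishes $P$ from $P'$ efficiently; and, for each $\Sigma$, the map $(G,\mathcal{P})\mapsto N_\Sigma(G,\mathcal{P})$ commutes with all graph isomorphisms $G\to G'$.
   Context: **Separations.** All graphs are finite, undirected and simple; $G$ has vertex set $V$. A separation of $G$ is a pair $(A,B)$ with $A,B\subseteq V$, $A\cup B=V$, such that $G$ has no edge between $A\setminus B$ and $B\setminus A$. Its order is $|A\cap B|$, its inverse is $(B,A)$; it is proper if neither $A\subseteq B$ nor $B\subseteq A$. A $k$-separation is one of order exactly $k$. Write $(A,B)\le(C,D)$ if $A\subseteq C$ and $B\supseteq D$. Two separations $(A,B),(C,D)$ are nested if $(A,B)$ is $\le$-comparable with $(C,D)$ or with $(D,C)$; otherwise they cross. A separation is nested with a set $S$ of separations if it is nested with every element of $S$. A set of separations is nested if every two of its elements are nested. A separation system is a set of separations closed under taking inverses; it is proper if all its elements are proper. A set of separations is antisymmetric if it contains no separation together with its inverse. **Profiles.** A set $P$ of separations is consistent if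 whenever $(A,B)\in P$ and $(C,D)\le(A,B)$ is a separation, then $(D,C)\notin P$. A profile is a consistent set $P$ of separations such that for all $(A,B),(C,D)\in P$ we have $(B\cap D,A\cup C)\notin P$. A $k$-profile is a profile $P$ all of whose elements have order $<k$ and which contains, for every separation $(A,B)$ of order $<k$, exactly one of $(A,B),(B,A)$. An antisymmetric set $P$ of separations orients a set $S$ of separations if for every $(A,B)\in S$ either $(A,B)\in P$ or $(B,A)\in P\cap S$; then $P\cap S$ is an orientation of $S$. A separation $(A,B)$ distinguishes two sets $P,P'$ of separations if $(A,B)\in P\setminus P'$ and $(B,A)\in P'\setminus P$, or vice versa. A set $S$ of separations distinguishes a set $\mathcal{P}$ of sets of separations if every two distinct elements of $\mathcal{P}$ are distinguished by some element of $S$. A separation $(A,B)$ splits a consistent set $O$ if both $O\cup\{(A,B)\}$ and $O\cup\{(B,A)\}$ are consistent. **Efficiency.** $\kappa(P,P')$ denotes the least order of a separation of $G$ that distinguishes the profiles $P,P'$. A separation of order $\ell$ that distinguishes $P$ from $P'$ does so efficiently if $\kappa(P,P')=\ell$. A separation is $\mathcal{P}$-essential if it efficiently distinguishes some pair of profiles in $\mathcal{P}$. **Tasks.** A task is a pair $(S,\mathcal{P})$ of a proper separation system $S$ and a set $\mathcal{P}$ of profiles in $G$ such that every $P\in\mathcal{P}$ orients $S$ and $S$ distinguishes $\mathcal{P}$. It is feasible if, whenever $(A,B),(C,D)\in S$ cross and there are $P,P'\in\mathcal{P}$ with $(A,B),(C,D)\in P$ and $(B,A),(D,C)\in P'$,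 there is $(E,F)\in P\cap S$ with $(A\cup C,B\cap D)\le(E,F)$. The reduction of $(S,\mathcal{P})$ is $(R,\mathcal{P})$, where $R$ is the set of those separations in $S$ that distinguish some two profiles in $\mathcal{P}$. **Operations.** A separation $(A,B)\in S$ is extremal in $S$ if every $(C,D)\in S$ satisfies $(C,D)\le(A,B)$ or $(D,C)\le(A,B)$. A profile $P$ orienting $S$ is well separated in $S$ if the set of $\le$-maximal elements of $P\cap S$ is nested. A separation is locally maximal in $(S,\mathcal{P})$ if it is $\le$-maximal in $P\cap S$ for some $P\in\mathcal{P}$ that is well separated in $S$. Let $\mathsf{ext}(S,\mathcal{P})$ be the set of extremal separations in $S$ and their inverses; $\mathsf{loc}(S,\mathcal{P})$ the set of locally maximal separations in $(S,\mathcal{P})$ and their inverses; $\mathsf{all}(S,\mathcal{P})$ the set of all separations in $S$ that are nested with every separation in $S$. With $(R,\mathcal{P})$ the reduction of $(S,\mathcal{P})$, let $\mathsf{ext_r}(S,\mathcal{P})=\mathsf{ext}(R,\mathcal{P})$, $\mathsf{loc_r}(S,\mathcal{P})=\mathsf{loc}(R,\mathcal{P})$, $\mathsf{all_r}(S,\mathcal{P})=\mathsf{all}(R,\mathcal{P})$. **Strategies.** A strategy is a map $\sigma:\mathbb{N}\to\{\mathsf{ext},\mathsf{loc},\mathsf{all},\mathsf{ext_r},\mathsf{loc_r},\mathsf{all_r}\}$ (with $0\in\mathbb{N}$) such that $\sigma(i)\in\{\mathsf{ext_r},\mathsf{loc_r},\mathsf{all_r}\}$ for infinitely many $i$. Let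 $\sigma^+(i)=\sigma(i+1)$, and let $r_\sigma$ be the least $r$ with $\sigma(r)\in\{\mathsf{ext_r},\mathsf{loc_r},\mathsf{all_r}\}$. For a nested separation system $N$, let $\mathcal{O}_N$ be the set of all consistent orientations of $N$; given $S$ and $\mathcal{P}$, for $O\in\mathcal{O}_N$ let $S_O$ be the set of separations in $S$ that split $O$ and $\mathcal{P}_O=\{P\in\mathcal{P}: P\cap N=O\}$. For a feasible task $(S,\mathcal{P})$ the set $N_\sigma(S,\mathcal{P})$ is defined by recursion on $|S|$ and, for fixed $|S|$, on $r_\sigma$: if $S=\emptyset$, then $N_\sigma(S,\mathcal{P})=\emptyset$. If $S\ne\emptyset$, $r_\sigma=0$ and the reduction $(R,\mathcal{P})$ of $(S,\mathcal{P})$ has $R\subsetneq S$, then $N_\sigma(S,\mathcal{P})=N_\sigma(R,\mathcal{P})$. In all other cases, with $N:=\sigma(0)(S,\mathcal{P})$, let $N_\sigma(S,\mathcal{P})=N\cup\bigcup_{O\in\mathcal{O}_N}N_{\sigma^+}(S_O,\mathcal{P}_O)$. **$k$-strategies.** A $k$-strategy is a $k$-tuple $\Sigma=(\sigma_1,\dots,\sigma_k)$ of strategies each with range in $\{\mathsf{ext_r},\mathsf{loc_r},\mathsf{all_r}\}$. For a set $\mathcal{P}$ of $k$-profiles and $1\le\ell\le k$ let $P_\ell=\{(A,B)\in P:|A\cap B|<\ell\}$ and $\mathcal{P}_\ell=\{P_\ell:P\in\mathcal{P}\}$. The set $N_\Sigma(G,\mathcal{P})$ determined by $\Sigma$ is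 defined recursively: for $k=1$, $N_\Sigma(G,\mathcal{P})=N_{\sigma_1}(S,\mathcal{P})$, where $S$ is the set of all proper separations of $G$ of order $<1$. For $k\ge2$ let $N=N_{(\sigma_1,\dots,\sigma_{k-1})}(G,\mathcal{P}_{k-1})$, let $S$ be the set of proper $(k-1)$-separations of $G$ that are nested with $N$, and put $N_\Sigma(G,\mathcal{P})=N\cup\bigcup_{O\in\mathcal{O}_N}N_{\sigma_k}(S_O,\mathcal{P}_O)$. (The recursion succeeding means in particular that the pairs to which $N_{\sigma_i}$ is applied are feasible tasks.) -}

module Defs where

open import Level using (0ℓ)
open import Data.Nat using (ℕ; zero; suc; _≤_; _<_; s≤s⁻¹)
open import Data.Fin using (Fin)
open import Data.Fin.Subset using (Subset; ∣_∣; ⊤)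
import Data.Fin.Subset as V
open import Data.Product using (Σ-syntax; ∃-syntax; _×_; _,_; swap)
open import Data.Sum using (_⊎_)
open import Data.Vec using (lookup; tabulate)
open import Data.Vec.Functional using (Vector; init; last)
open import Function.Bundles using (_↔_; _⇔_; module Inverse)
open import Relation.Nullary using (¬_)
open import Relation.Unary using (Pred; Empty; ｛_｝; _∈_; _∉_; _⊆_; _⊂_; _≐_; _∪_; _∩_; _∖_)
open import Relation.Binary.Core using (Rel)
open import Relation.Binary.Definitions using (Decidable; Symmetric; Irreflexive)
open import Relation.Binary.PropositionalEquality using (_≡_)

record Graph (n : ℕ) : Set₁ where
  field
    Adj    : Rel (Fin n) 0ℓ
    adj?   : Decidable Adj
    sym    : Symmetric Adj
    irrefl : Irreflexive _≡_ Adj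

record _≅_ {n n′ : ℕ} (G : Graph n) (G′ : Graph n′) : Set where
  field
    bijection : Fin n ↔ Fin n′
  open Inverse bijection public using (to; from)
  field
    preserves : ∀ u v → Graph.Adj G u v ⇔ Graph.Adj G′ (to u) (to v)

------------------------------------------------------------------------
-- Separations

-- Being a separation is a predicate on pairs (A , B) of vertex sets, so
-- that equality of separations is equality of pairs. Vertex sets carry the
-- prefix V; the unprefixed set operations act on sets of separations.

Pair : ℕ → Set
Pair n = Subset n × Subset n

SepSet : ℕ → Set₁
SepSet n = Pred (Pair n) 0ℓ

private variable
  n n′ : ℕ

inv : Pair n → Pair n
inv = swap

order : Pair n → ℕ
order (A , B) = ∣ A V.∩ B ∣

IsSeparation : Graph n → SepSet n
IsSeparation G (A , B) =
  A V.∪ B ≡ ⊤ ×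
  (∀ {u v} → u V.∈ A V.─ B → v V.∈ B V.─ A → ¬ Graph.Adj G u v)

Proper : SepSet n
Proper (A , B) = ¬ (A V.⊆ B) × ¬ (B V.⊆ A)

infix 4 _≼_
_≼_ : Rel (Pair n) 0ℓ
(A , B) ≼ (C , D) = A V.⊆ C × D V.⊆ B

_∨_ : Pair n → Pair n → Pair n
(A , B) ∨ (C , D) = (A V.∪ C , B V.∩ D)

Comparable : Rel (Pair n) 0ℓ
Comparable s t = s ≼ t ⊎ t ≼ s

Nested : Rel (Pair n) 0ℓ
Nested s t = Comparable s t ⊎ Comparable s (inv t)

Cross : Rel (Pair n) 0ℓ
Cross s t = ¬ Nested s t

NestedWith : SepSet n → SepSet n
NestedWith S s = ∀ {t} → t ∈ S → Nested s t

NestedSet : SepSet n → Set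
NestedSet S = ∀ {s t} → s ∈ S → t ∈ S → Nested s t

record IsSystem (G : Graph n) (S : SepSet n) : Set where
  field
    separations : S ⊆ IsSeparation G
    inv-closed  : ∀ {s} → s ∈ S → inv s ∈ S

record IsNestedSystem (G : Graph n) (S : SepSet n) : Set where
  field
    isSystem : IsSystem G S
    nested   : NestedSet S

Antisymmetric : SepSet n → Set
Antisymmetric P = ∀ {s} → s ∈ P → inv s ∉ P

------------------------------------------------------------------------
-- Profiles

Consistent : Graph n → SepSet n → Set
Consistent G P = ∀ {s t} → s ∈ P → t ∈ IsSeparation G → t ≼ s → inv t ∉ P

record IsProfile (G : Graph n) (P : SepSet n) : Set where
  field
    separations : P ⊆ IsSeparation G
    consistent  : Consistent G P
    profile     : ∀ {s t} → s ∈ P → t ∈ P → inv (s ∨ t) ∉ P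

record IsKProfile (G : Graph n) (k : ℕ) (P : SepSet n) : Set where
  field
    isProfile  : IsProfile G P
    small      : ∀ {s} → s ∈ P → order s < k
    exactlyOne : ∀ {s} → s ∈ IsSeparation G → order s < k →
                 (s ∈ P × inv s ∉ P) ⊎ (s ∉ P × inv s ∈ P)

Orients : SepSet n → SepSet n → Set
Orients P S = Antisymmetric P × (∀ {s} → s ∈ S → s ∈ P ⊎ inv s ∈ P ∩ S)

-- The consistent orientations of N. A set P ∩ N with P orienting N itself
-- orients N, so the orientations of N are its subsets that orient it.
𝒪 : Graph n → SepSet n → Pred (SepSet n) 0ℓ
𝒪 G N O = O ⊆ N × Orients O N × Consistent G O

Distinguishes : Pair n → SepSet n → SepSet n → Set
Distinguishes s P Q =
  (s ∈ P ∖ Q × inv s ∈ Q ∖ P) ⊎ (s ∈ Q ∖ P × inv s ∈ P ∖ Q)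

Splits : Graph n → Pair n → SepSet n → Set
Splits G s O = Consistent G (O ∪ ｛ s ｝) × Consistent G (O ∪ ｛ inv s ｝)

-- κ G P Q ℓ : the least order of a separation distinguishing P from Q is ℓ.
κ : Graph n → SepSet n → SepSet n → ℕ → Set
κ G P Q ℓ =
  (∃[ s ] s ∈ IsSeparation G × Distinguishes s P Q × order s ≡ ℓ) ×
  (∀ {s} → s ∈ IsSeparation G → Distinguishes s P Q → ℓ ≤ order s)

EfficientlyDistinguishes : Graph n → Pair n → SepSet n → SepSet n → Set
EfficientlyDistinguishes G s P Q =
  s ∈ IsSeparation G × Distinguishes s P Q × κ G P Q (order s)

-- A set of sets of separations is given as the image of a family with a
-- small index type, which keeps quantification over it in Set. Members with
-- different indices may coincide; 'distinct' always means ¬ (P ≐ Q).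
record Family (n : ℕ) : Set₁ where
  constructor family
  field
    Index : Set
    _at_  : Index → SepSet n

open Family public

infix 4 _≈ᶠ_
_≈ᶠ_ : Family n → Family n → Set
𝒫 ≈ᶠ 𝒬 = (∀ i → ∃[ j ] 𝒫 at i ≐ 𝒬 at j) × (∀ j → ∃[ i ] 𝒫 at i ≐ 𝒬 at j)

DistinguishesSomeTwo : Family n → SepSet n
DistinguishesSomeTwo 𝒫 s = ∃[ i ] ∃[ j ] Distinguishes s (𝒫 at i) (𝒫 at j)

DistinguishesAll : SepSet n → Family n → Set
DistinguishesAll S 𝒫 = ∀ i j → ¬ (𝒫 at i ≐ 𝒫 at j) →
  ∃[ s ] s ∈ S × Distinguishes s (𝒫 at i) (𝒫 at j)

EfficientlyDistinguishesAll : Graph n → SepSet n → Family n → Set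
EfficientlyDistinguishesAll G S 𝒫 = ∀ i j → ¬ (𝒫 at i ≐ 𝒫 at j) →
  ∃[ s ] s ∈ S × EfficientlyDistinguishes G s (𝒫 at i) (𝒫 at j)

Essential : Graph n → Family n → SepSet n
Essential G 𝒫 s = ∃[ i ] ∃[ j ] EfficientlyDistinguishes G s (𝒫 at i) (𝒫 at j)

------------------------------------------------------------------------
-- Tasks

record IsTask (G : Graph n) (S : SepSet n) (𝒫 : Family n) : Set where
  field
    isSystem      : IsSystem G S
    proper        : S ⊆ Proper
    profiles      : ∀ i → IsProfile G (𝒫 at i)
    orients       : ∀ i → Orients (𝒫 at i) S
    distinguishes : DistinguishesAll S 𝒫

record IsFeasible (G : Graph n) (S : SepSet n) (𝒫 : Family n) : Set where
  field
    isTask   : IsTask G S 𝒫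
    feasible : ∀ {s t} → s ∈ S → t ∈ S → Cross s t →
               ∀ i j → s ∈ 𝒫 at i → t ∈ 𝒫 at i → inv s ∈ 𝒫 at j → inv t ∈ 𝒫 at j →
               ∃[ e ] e ∈ 𝒫 at i ∩ S × s ∨ t ≼ e

reduction : SepSet n → Family n → SepSet n
reduction S 𝒫 = S ∩ DistinguishesSomeTwo 𝒫

------------------------------------------------------------------------
-- Operations

Extremal : SepSet n → SepSet n
Extremal S s = s ∈ S × (∀ {t} → t ∈ S → t ≼ s ⊎ inv t ≼ s)

Maximal : SepSet n → SepSet n
Maximal X s = s ∈ X × (∀ {t} → t ∈ X → s ≼ t → t ≡ s)

WellSeparated : SepSet n → SepSet n → Set
WellSeparated P S = NestedSet (Maximal (P ∩ S))

LocallyMaximal : SepSet n → Family n → SepSet n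
LocallyMaximal S 𝒫 s =
  ∃[ i ] WellSeparated (𝒫 at i) S × s ∈ Maximal (𝒫 at i ∩ S)

withInverses : SepSet n → SepSet n
withInverses X s = s ∈ X ⊎ inv s ∈ X

data Operation : Set where
  ext loc all extᵣ locᵣ allᵣ : Operation

data IsReducing : Operation → Set where
  extᵣ : IsReducing extᵣ
  locᵣ : IsReducing locᵣ
  allᵣ : IsReducing allᵣ

⟦_⟧ : Operation → SepSet n → Family n → SepSet n
⟦ ext ⟧  S 𝒫 = withInverses (Extremal S)
⟦ loc ⟧  S 𝒫 = withInverses (LocallyMaximal S 𝒫)
⟦ all ⟧  S 𝒫 = S ∩ NestedWith S
⟦ extᵣ ⟧ S 𝒫 = ⟦ ext ⟧ (reduction S 𝒫) 𝒫
⟦ locᵣ ⟧ S 𝒫 = ⟦ loc ⟧ (reduction S 𝒫) 𝒫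
⟦ allᵣ ⟧ S 𝒫 = ⟦ all ⟧ (reduction S 𝒫) 𝒫

------------------------------------------------------------------------
-- Strategies

record Strategy : Set where
  field
    op              : ℕ → Operation
    infinitelyOften : ∀ m → ∃[ i ] m ≤ i × IsReducing (op i)

open Strategy public

shift : Strategy → Strategy
shift σ .op i = σ .op (suc i)
shift σ .infinitelyOften m with σ .infinitelyOften (suc m)
... | suc i , m<i , red = i , s≤s⁻¹ m<i , red

-- r[ σ ]≡ r : the least index of a reducing operation of σ is r.
r[_]≡_ : Strategy → ℕ → Set
r[ σ ]≡ r = IsReducing (σ .op r) × (∀ {i} → i < r → ¬ IsReducing (σ .op i))

splitBy : Graph n → SepSet n → SepSet n → SepSet n
splitBy G S O s = s ∈ S × Splits G s O

inducing : Family n → SepSet n → SepSet n → Family n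
inducing 𝒫 N O = family (∃[ i ] 𝒫 at i ∩ N ≐ O) (λ (i , _) → 𝒫 at i)

-- N together with the union of the sets M O over the consistent
-- orientations O of N.
assemble : Graph n → SepSet n → (SepSet n → SepSet n) → Pred (Pair n) _
assemble G N M = N ∪ (λ s → ∃[ O ] O ∈ 𝒪 G N × s ∈ M O)

-- The passage from (S , σ) to (S′ , shift σ), where S′ ⊆ S, makes the pair
-- (|S| , r_σ) lexicographically smaller.
Decreases : Strategy → SepSet n → SepSet n → Set
Decreases σ S S′ =
  S′ ⊂ S ⊎ (∃[ r ] ∃[ r⁺ ] r[ σ ]≡ r × r[ shift σ ]≡ r⁺ × r⁺ < r)

-- Nσ G σ S 𝒫 N : the recursion defining N_σ(S , 𝒫) succeeds with value N.
-- A derivation is a finitely deep tree of recursive calls, each of them made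
-- on a feasible task and, in 'step', branching over a set N₀ that is a nested
-- separation system. In 'reduce', |S| decreases by assumption.
data Nσ (G : Graph n) (σ : Strategy) (S : SepSet n) (𝒫 : Family n) (N : SepSet n) :
     Set₁ where

  empty : IsFeasible G S 𝒫 → Empty S → Empty N → Nσ G σ S 𝒫 N

  reduce : IsFeasible G S 𝒫 → ¬ Empty S →
           r[ σ ]≡ 0 → reduction S 𝒫 ⊂ S →
           Nσ G σ (reduction S 𝒫) 𝒫 N →
           Nσ G σ S 𝒫 N

  step : IsFeasible G S 𝒫 → ¬ Empty S →
         ¬ (r[ σ ]≡ 0 × reduction S 𝒫 ⊂ S) →
         let N₀ = ⟦ σ .op 0 ⟧ S 𝒫 in
         IsNestedSystem G N₀ →
         (M : SepSet n → SepSet n) →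
         (∀ {O} → O ∈ 𝒪 G N₀ →
            Decreases σ S (splitBy G S O) ×
            Nσ G (shift σ) (splitBy G S O) (inducing 𝒫 N₀ O) (M O)) →
         N ≐ assemble G N₀ M →
         Nσ G σ S 𝒫 N

record KStrategy (k : ℕ) : Set where
  field
    strategies : Vector Strategy k
    reducing   : ∀ ℓ i → IsReducing (strategies ℓ .op i)

open KStrategy public

restrict : ℕ → Family n → Family n
restrict ℓ 𝒫 = family (𝒫 .Index) (λ i s → s ∈ 𝒫 at i × order s < ℓ)

-- NΣ G m Σ 𝒫 N : the recursion defining N_Σ(G , 𝒫) for the k-tuple Σ, where
-- k = suc m, succeeds with value N.
NΣ : Graph n → (m : ℕ) → Vector Strategy (suc m) → Family n → SepSet n → Set₁
NΣ G zero Σ 𝒫 N = Nσ G (last Σ) S 𝒫 N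
  where
  S : SepSet _
  S s = s ∈ IsSeparation G × s ∈ Proper × order s < 1
NΣ {n} G (suc m) Σ 𝒫 N′ =
  ∃[ N ] NΣ G m (init Σ) (restrict (suc m) 𝒫) N × IsNestedSystem G N ×
  Σ[ M ∈ (SepSet n → SepSet n) ]
    (∀ {O} → O ∈ 𝒪 G N →
       Nσ G (last Σ) (splitBy G (S N) O) (inducing 𝒫 N O) (M O)) ×
    N′ ≐ assemble G N M
  where
  S : SepSet n → SepSet n
  S N s = s ∈ IsSeparation G × s ∈ Proper × order s ≡ suc m × s ∈ NestedWith N

------------------------------------------------------------------------
-- Images under an isomorphism

module _ {G : Graph n} {G′ : Graph n′} (φ : G ≅ G′) where

  -- v ∈ φ(A) iff φ⁻¹(v) ∈ A
  imageᵛ : Subset n → Subset n′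
  imageᵛ A = tabulate (λ v → lookup A (_≅_.from φ v))

  image : SepSet n → SepSet n′
  image P (C , D) = ∃[ A ] ∃[ B ] (A , B) ∈ P × imageᵛ A ≡ C × imageᵛ B ≡ D

  imageᶠ : Family n → Family n′
  imageᶠ 𝒫 = family (𝒫 .Index) (λ i → image (𝒫 at i))

{-# OPTIONS --safe #-}
module Submission where

-- Reductions and the tasks (S_O , 𝒫_O) inherit feasibility. In a reduced
-- feasible task every maximal separation is extremal: if some element of S
-- crossed it, feasibility would yield an element of S above their join. So
-- every reducing operation makes progress, and what it selects is nested with S. A
-- separation s splits at most one orientation of N, namely the elements of N
-- below s or its inverse, which makes the union over all orientations nested.
-- For k-strategies, two profiles inducing the same orientation of N agree on
-- all separations of order below k - 1. By modularity of the order, a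
-- (k-1)-separation distinguishing them can be replaced by a corner with any
-- element of N that it crosses, and corners inherit nestedness, so one nested
-- with all of N is found by treating the elements of N one at a time.

open import Defs
open import Data.Bool using (true; false; if_then_else_)
import Data.Bool.Properties as Bool
open import Data.Empty using (⊥; ⊥-elim)
open import Data.Fin using (Fin)
open import Data.Fin.Properties using (any?; all?)
open import Data.Fin.Subset using (Subset; ∣_∣; ⊤)
import Data.Fin.Permutation as Perm
import Data.Fin.Subset as V
import Data.Fin.Subset.Properties as V
open import Data.List using (List; []; _∷_; cartesianProduct; cartesianProductWith; filter; length)
open import Data.List.Membership.Propositional using () renaming (_∈_ to _∈ˡ_)
open import Data.List.Membership.Propositional.Properties
  using (∈-cartesianProduct⁺; ∈-cartesianProductWith⁺; ∈-filter⁺)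
open import Data.List.Properties using (filter-notAll)
import Data.List.Relation.Unary.Any as Any
open import Data.List.Relation.Unary.Any using (here; there)
open import Data.Nat using (ℕ; zero; suc; _+_; _≤_; _<_; z≤n; s≤s; _<?_; _≤?_; s≤s⁻¹)
open import Data.Nat.Properties
open import Algebra.Properties.CommutativeMonoid.Sum +-0-commutativeMonoid
  using (sum; sum-permute; sum-cong-≗)
open import Data.Product using (∃-syntax; Σ-syntax; ∃; _×_; _,_; proj₁; proj₂)
import Data.Product.Properties as Prod
open import Data.Sum using (_⊎_; inj₁; inj₂)
import Data.Sum as Sum
open import Data.Vec using ([]; _∷_; lookup; here; there)
import Data.Vec.Properties as Vec
open import Data.Vec.Functional using (Vector; init; last)
open import Function using (_∘_; id)
open import Function.Bundles using (mk⇔; module Equivalence; module Inverse)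
open import Relation.Binary.Definitions using (DecidableEquality) renaming (Decidable to Decidable₂)
open import Relation.Binary.PropositionalEquality
  using (_≡_; refl; sym; trans; cong; cong₂; subst; subst₂; module ≡-Reasoning)
open import Relation.Nullary using (¬_; Dec; yes; no; contradiction)
open import Relation.Nullary.Decidable
  using (map′; ¬?; _×-dec_; _⊎-dec_; _→-dec_; decidable-stable)
open import Relation.Unary
  using (Decidable; Empty; ｛_｝; _∈_; _∉_; _⊆_; _⊂_; _≐_; _∪_; _∩_; _∖_)

-- The recursion is a relation, so its success and its properties are separate matters: nestedness
-- and the distinguishing property are read off an arbitrary derivation. Canonicity compares two
-- derivations on tasks that correspond under a `Transport`. The identity transport turns this into
-- uniqueness of the value, on which success itself relies: the union over all orientations is only
-- well behaved if orientations with the same elements have the same value. No classical axiom is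
-- available. Deciding whether to reduce, or whether two profiles induce the same orientation, takes
-- a search through finitely many pairs, so decidability of the sets involved is carried through
-- every construction.

private variable
  n n′ : ℕ

-- The order on separations

≼-refl : {s : Pair n} → s ≼ s
≼-refl = id , id

≼-trans : {s t u : Pair n} → s ≼ t → t ≼ u → s ≼ u
≼-trans (a , b) (c , d) = (λ x → c (a x)) , (λ x → b (d x))

≼-antisym : {s t : Pair n} → s ≼ t → t ≼ s → s ≡ t
≼-antisym (a , b) (c , d) = cong₂ _,_ (V.⊆-antisym a c) (V.⊆-antisym d b)

inv-anti : {s t : Pair n} → s ≼ t → inv t ≼ inv s
inv-anti (a , b) = b , a

∨-upperˡ : (s t : Pair n) → s ≼ s ∨ t
∨-upperˡ (A , B) (C , D) = V.p⊆p∪q C , V.p∩q⊆p B D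

∨-upperʳ : (s t : Pair n) → t ≼ s ∨ t
∨-upperʳ (A , B) (C , D) = V.q⊆p∪q A C , V.p∩q⊆q B D

∨-least : (s t : Pair n) {u : Pair n} → s ≼ u → t ≼ u → s ∨ t ≼ u
∨-least (A , B) (C , D) (a , b) (c , d) =
  (λ x → Sum.[ a , c ] (V.x∈p∪q⁻ A C x)) , (λ x → V.x∈p∩q⁺ (b x , d x))

nested-sym : {s t : Pair n} → Nested s t → Nested t s
nested-sym (inj₁ (inj₁ p)) = inj₁ (inj₂ p)
nested-sym (inj₁ (inj₂ p)) = inj₁ (inj₁ p)
nested-sym (inj₂ (inj₁ p)) = inj₂ (inj₁ (inv-anti p))
nested-sym (inj₂ (inj₂ p)) = inj₂ (inj₂ (inv-anti p))

nested-invʳ : {s t : Pair n} → Nested s t → Nested s (inv t)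
nested-invʳ (inj₁ c) = inj₂ c
nested-invʳ (inj₂ c) = inj₁ c

nested-invˡ : {s t : Pair n} → Nested s t → Nested (inv s) t
nested-invˡ p = nested-sym (nested-invʳ (nested-sym p))

nested-∨ʳ : (s t : Pair n) → Nested (s ∨ t) t
nested-∨ʳ s t = inj₁ (inj₂ (∨-upperʳ s t))

-- The fish lemma. If `t` or `inv t` lies below `s` or `r`, it lies below the join. Otherwise each
-- of `s` and `r` lies below `t` or `inv t`, and both below the same one: `s ≼ t` with `r ≼ inv t`
-- would give `s ≼ inv r`, and the two would not cross.
nested-∨ : (s r t : Pair n) → Cross s r → Nested t s → Nested t r → Nested t (s ∨ r)
nested-∨ s r t s×r t∥s t∥r with t∥s | t∥r
... | inj₁ (inj₁ t≼s) | _ = inj₁ (inj₁ (≼-trans t≼s (∨-upperˡ s r)))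
... | inj₂ (inj₂ s*≼t) | _ = inj₂ (inj₂ (≼-trans (inv-anti (∨-upperˡ s r)) s*≼t))
... | _ | inj₁ (inj₁ t≼r) = inj₁ (inj₁ (≼-trans t≼r (∨-upperʳ s r)))
... | _ | inj₂ (inj₂ r*≼t) = inj₂ (inj₂ (≼-trans (inv-anti (∨-upperʳ s r)) r*≼t))
... | inj₁ (inj₂ s≼t) | inj₁ (inj₂ r≼t) = inj₁ (inj₂ (∨-least s r s≼t r≼t))
... | inj₂ (inj₁ t≼s*) | inj₂ (inj₁ t≼r*) =
      inj₂ (inj₁ (inv-anti (∨-least s r (inv-anti t≼s*) (inv-anti t≼r*))))
... | inj₁ (inj₂ s≼t) | inj₂ (inj₁ t≼r*) =
      contradiction (inj₂ (inj₁ (≼-trans s≼t t≼r*))) s×r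
... | inj₂ (inj₁ t≼s*) | inj₁ (inj₂ r≼t) =
      contradiction (inj₂ (inj₁ (≼-trans (inv-anti t≼s*) (inv-anti r≼t)))) s×r

-- Orders of separations

order-inv : (s : Pair n) → order (inv s) ≡ order s
order-inv (A , B) = cong ∣_∣ (V.∩-comm B A)

-- Counted one vertex at a time. The covering hypotheses leave nine cases; a vertex outside `A` and
-- `B` but in `C` and `D` would count on the right only.
∣∨∣-modular : (A B C D : Subset n) → A V.∪ B ≡ ⊤ → C V.∪ D ≡ ⊤ →
  order ((A , B) ∨ (C , D)) + order ((B , A) ∨ (D , C)) ≡ order (A , B) + order (C , D)
∣∨∣-modular [] [] [] [] _ _ = refl
∣∨∣-modular (a ∷ A) (b ∷ B) (c ∷ C) (d ∷ D) ab cd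
  with ih ← ∣∨∣-modular A B C D (Vec.∷-injectiveʳ ab) (Vec.∷-injectiveʳ cd)
  with a | b | c | d | Vec.∷-injectiveˡ ab | Vec.∷-injectiveˡ cd
... | true  | true  | true  | true  | _ | _ = cong suc (trans (+-suc _ _) (trans (cong suc ih) (sym (+-suc _ _))))
... | true  | true  | true  | false | _ | _ = trans (+-suc _ _) (cong suc ih)
... | true  | true  | false | true  | _ | _ = cong suc ih
... | true  | false | true  | true  | _ | _ = trans (+-suc _ _) (trans (cong suc ih) (sym (+-suc _ _)))
... | true  | false | true  | false | _ | _ = ih
... | true  | false | false | true  | _ | _ = ih
... | false | true  | true  | true  | _ | _ = trans (cong suc ih) (sym (+-suc _ _))
... | false | true  | true  | false | _ | _ = ih
... | false | true  | false | true  | _ | _ = ih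

x∈p─q⇒x∉q : (p q : Subset n) {x : Fin n} → x V.∈ p V.─ q → x V.∉ q
x∈p─q⇒x∉q (_ ∷ p) (true ∷ q)  (there x∈) (there x∈q) = x∈p─q⇒x∉q p q x∈ x∈q
x∈p─q⇒x∉q (_ ∷ p) (false ∷ q) (there x∈) (there x∈q) = x∈p─q⇒x∉q p q x∈ x∈q

module _ (G : Graph n) where
  open Graph G using (Adj; adj?) renaming (sym to adj-sym)

  separation-cover : ∀ {s} → s ∈ IsSeparation G → ∀ v → v V.∈ proj₁ s ⊎ v V.∈ proj₂ s
  separation-cover {A , B} (cover , _) v = V.x∈p∪q⁻ A B (subst (v V.∈_) (sym cover) V.∈⊤)

  separation-inv : ∀ {s} → s ∈ IsSeparation G → inv s ∈ IsSeparation G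
  separation-inv {A , B} (cover , none) =
    trans (V.∪-comm B A) cover , λ u v uv → none v u (adj-sym uv)

  separation-∨ : ∀ {s t} → s ∈ IsSeparation G → t ∈ IsSeparation G → (s ∨ t) ∈ IsSeparation G
  separation-∨ {s@(A , B)} {t@(C , D)} sep-s@(_ , none) sep-t@(_ , none′) =
    V.⊆-antisym V.⊆⊤ (λ {v} _ → cover v) ,
    λ {u} {v} u∈ v∈ →
      separate u v (V.x∈p∪q⁻ A C (V.p─q⊆p _ _ u∈)) (x∈p─q⇒x∉q _ _ u∈)
        (V.x∈p∩q⁻ B D (V.p─q⊆p _ _ v∈)) (x∈p─q⇒x∉q _ _ v∈)
    where
    cover : ∀ v → v V.∈ (A V.∪ C) V.∪ (B V.∩ D)
    cover v with separation-cover sep-s v | separation-cover sep-t v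
    ... | inj₁ a | _ = V.x∈p∪q⁺ (inj₁ (V.x∈p∪q⁺ (inj₁ a)))
    ... | inj₂ _ | inj₁ c = V.x∈p∪q⁺ (inj₁ (V.x∈p∪q⁺ (inj₂ c)))
    ... | inj₂ b | inj₂ d = V.x∈p∪q⁺ (inj₂ (V.x∈p∩q⁺ (b , d)))

    separate : ∀ u v → u V.∈ A ⊎ u V.∈ C → u V.∉ B V.∩ D →
               v V.∈ B × v V.∈ D → v V.∉ A V.∪ C → ¬ Adj u v
    separate u v _ u∉B∩D (v∈B , v∈D) v∉A∪C
      with u V.∈? B | u V.∈? D | separation-cover sep-s u | separation-cover sep-t u
    ... | yes u∈B | yes u∈D | _ | _ = contradiction (V.x∈p∩q⁺ (u∈B , u∈D)) u∉B∩D
    ... | no u∉B | _ | inj₁ u∈A | _ =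
          none (V.x∈p∧x∉q⇒x∈p─q u∈A u∉B) (V.x∈p∧x∉q⇒x∈p─q v∈B (v∉A∪C ∘ V.x∈p∪q⁺ ∘ inj₁))
    ... | no u∉B | _ | inj₂ u∈B | _ = contradiction u∈B u∉B
    ... | _ | no u∉D | _ | inj₁ u∈C =
          none′ (V.x∈p∧x∉q⇒x∈p─q u∈C u∉D) (V.x∈p∧x∉q⇒x∈p─q v∈D (v∉A∪C ∘ V.x∈p∪q⁺ ∘ inj₂))
    ... | _ | no u∉D | _ | inj₂ u∈D = contradiction u∈D u∉D

  order-∨ : ∀ {s t} → s ∈ IsSeparation G → t ∈ IsSeparation G →
    order (s ∨ t) + order (inv s ∨ inv t) ≡ order s + order t
  order-∨ {A , B} {C , D} (ab , _) (cd , _) = ∣∨∣-modular A B C D ab cd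

-- Finite search

anyPair? : {Q : SepSet n} → Decidable Q → Dec (∃ Q)
anyPair? Q? = map′ (λ (A , B , q) → (A , B) , q) (λ ((A , B) , q) → A , B , q)
  (V.anySubset? λ A → V.anySubset? λ B → Q? (A , B))

allPairs? : {Q : SepSet n} → Decidable Q → Dec (∀ {s} → Q s)
allPairs? Q? with anyPair? (λ s → ¬? (Q? s))
... | yes (s , ¬q) = no λ q → ¬q q
... | no ¬∃        = yes λ {s} → decidable-stable (Q? s) λ ¬q → ¬∃ (s , ¬q)

infix 4 _≟ᵖ_ _≼?_
_≟ᵖ_ : DecidableEquality (Pair n)
_≟ᵖ_ = Prod.≡-dec (Vec.≡-dec Bool._≟_) (Vec.≡-dec Bool._≟_)

_≼?_ : Decidable₂ (_≼_ {n})
(A , B) ≼? (C , D) = (A V.⊆? C) ×-dec (D V.⊆? B)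

nested? : Decidable₂ (Nested {n})
nested? s t = (s ≼? t ⊎-dec t ≼? s) ⊎-dec (s ≼? inv t ⊎-dec inv t ≼? s)

⊆-dec : {S T : SepSet n} → Decidable S → Decidable T → Dec (S ⊆ T)
⊆-dec S? T? = allPairs? λ s → S? s →-dec T? s

≐-dec : {S T : SepSet n} → Decidable S → Decidable T → Dec (S ≐ T)
≐-dec S? T? = ⊆-dec S? T? ×-dec ⊆-dec T? S?

infixr 6 _∩?_ _∖?_
_∩?_ : {S T : SepSet n} → Decidable S → Decidable T → Decidable (S ∩ T)
(S? ∩? T?) s = S? s ×-dec T? s

_∖?_ : {S T : SepSet n} → Decidable S → Decidable T → Decidable (S ∖ T)
(S? ∖? T?) s = S? s ×-dec ¬? (T? s)

nestedWith? : {S : SepSet n} → Decidable S → Decidable (NestedWith S)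
nestedWith? S? s = allPairs? λ t → S? t →-dec nested? s t

proper? : Decidable (Proper {n})
proper? (A , B) = ¬? (A V.⊆? B) ×-dec ¬? (B V.⊆? A)

separation? : (G : Graph n) → Decidable (IsSeparation G)
separation? G (A , B) =
  Vec.≡-dec Bool._≟_ (A V.∪ B) ⊤ ×-dec
  map′ (λ f {u} {v} → f u v) (λ f u v → f)
    (all? λ u → all? λ v → (u V.∈? A V.─ B) →-dec (v V.∈? B V.─ A) →-dec ¬? (Graph.adj? G u v))

consistent? : (G : Graph n) {P : SepSet n} → Decidable P → Dec (Consistent G P)
consistent? G P? = allPairs? λ s → allPairs? λ t →
  P? s →-dec separation? G t →-dec t ≼? s →-dec ¬? (P? (inv t))

orients? : {P S : SepSet n} → Decidable P → Decidable S → Dec (Orients P S)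
orients? P? S? =
  (allPairs? λ s → P? s →-dec ¬? (P? (inv s))) ×-dec
  (allPairs? λ s → S? s →-dec (P? s ⊎-dec (P? ∩? S?) (inv s)))

𝒪? : (G : Graph n) {N O : SepSet n} → Decidable N → Decidable O → Dec (O ∈ 𝒪 G N)
𝒪? G N? O? = ⊆-dec O? N? ×-dec orients? O? N? ×-dec consistent? G O?

splits? : (G : Graph n) {O : SepSet n} → Decidable O → Decidable (λ s → Splits G s O)
splits? G O? s =
  consistent? G (λ t → O? t ⊎-dec s ≟ᵖ t) ×-dec consistent? G (λ t → O? t ⊎-dec inv s ≟ᵖ t)

distinguishes? : {P Q : SepSet n} → Decidable P → Decidable Q → Decidable (λ s → Distinguishes s P Q)
distinguishes? P? Q? s =
  ((P? ∖? Q?) s ×-dec (Q? ∖? P?) (inv s)) ⊎-dec ((Q? ∖? P?) s ×-dec (P? ∖? Q?) (inv s))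

extremal? : {S : SepSet n} → Decidable S → Decidable (Extremal S)
extremal? S? s = S? s ×-dec allPairs? λ t → S? t →-dec (t ≼? s ⊎-dec inv t ≼? s)

maximal? : {S : SepSet n} → Decidable S → Decidable (Maximal S)
maximal? S? s = S? s ×-dec allPairs? λ t → S? t →-dec s ≼? t →-dec t ≟ᵖ s

nestedSet? : {S : SepSet n} → Decidable S → Dec (NestedSet S)
nestedSet? S? = allPairs? λ s → allPairs? λ t → S? s →-dec S? t →-dec nested? s t

subsets : (n : ℕ) → List (Subset n)
subsets zero    = [] ∷ []
subsets (suc n) = cartesianProductWith _∷_ (true ∷ false ∷ []) (subsets n)

∈-subsets : (A : Subset n) → A ∈ˡ subsets n
∈-subsets []          = here refl
∈-subsets (true  ∷ A) = ∈-cartesianProductWith⁺ _∷_ {xs = true ∷ false ∷ []} (here refl) (∈-subsets A)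
∈-subsets (false ∷ A) = ∈-cartesianProductWith⁺ _∷_ {xs = true ∷ false ∷ []} (there (here refl)) (∈-subsets A)

pairs : (n : ℕ) → List (Pair n)
pairs n = cartesianProduct (subsets n) (subsets n)

∈-pairs : (s : Pair n) → s ∈ˡ pairs n
∈-pairs (A , B) = ∈-cartesianProduct⁺ (∈-subsets A) (∈-subsets B)

maximal-above : {X : SepSet n} → Decidable X → ∀ {x} → x ∈ X → ∃[ y ] x ≼ y × y ∈ Maximal X
maximal-above {n} {X} X? {x} x∈X with go (pairs n)
  where
  go : (L : List (Pair n)) →
       ∃[ y ] x ≼ y × y ∈ X × (∀ {t} → t ∈ˡ L → t ∈ X → y ≼ t → t ≡ y)
  go [] = x , ≼-refl , x∈X , λ ()
  go (t ∷ L) with go L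
  ... | y , x≼y , y∈X , max with X? t ×-dec y ≼? t
  -- A scanned element of `X` above `t` lies above `y`, hence equals `y`, and so is also below `t`.
  ...   | yes (t∈X , y≼t) = t , ≼-trans x≼y y≼t , t∈X , λ where
            (here refl) _ _ → refl
            (there u∈L) u∈X t≼u → ≼-antisym
              (subst (_≼ t) (sym (max u∈L u∈X (≼-trans y≼t t≼u))) y≼t) t≼u
  ...   | no ¬p = y , x≼y , y∈X , λ where
            (here refl) t∈X y≼t → contradiction (t∈X , y≼t) ¬p
            (there u∈L) u∈X y≼u → max u∈L u∈X y≼u
... | y , x≼y , y∈X , max = y , x≼y , y∈X , λ {t} → max (∈-pairs t)

-- Profiles

consistent-⊆ : (G : Graph n) {P Q : SepSet n} → P ⊆ Q → Consistent G Q → Consistent G P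
consistent-⊆ G P⊆Q consistent s∈P sep t≼s inv-t∈P = consistent (P⊆Q s∈P) sep t≼s (P⊆Q inv-t∈P)

∪-⊆ : {O P : SepSet n} {s : Pair n} → O ⊆ P → s ∈ P → O ∪ ｛ s ｝ ⊆ P
∪-⊆ O⊆P s∈P (inj₁ t∈O)  = O⊆P t∈O
∪-⊆ O⊆P s∈P (inj₂ refl) = s∈P

-- The reason why `S_O` keeps what tells apart the profiles inducing `O`: these are consistent sets
-- extending `O`, one by `s` and the other by `inv s`.
between⇒splits : (G : Graph n) {O P Q : SepSet n} {s : Pair n} → Consistent G P → Consistent G Q →
  O ⊆ P → O ⊆ Q → s ∈ P → inv s ∈ Q → Splits G s O
between⇒splits G P-cons Q-cons O⊆P O⊆Q s∈P inv-s∈Q =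
  consistent-⊆ G (∪-⊆ O⊆P s∈P) P-cons , consistent-⊆ G (∪-⊆ O⊆Q inv-s∈Q) Q-cons

splits-inv : (G : Graph n) {O : SepSet n} {s : Pair n} → Splits G s O → Splits G (inv s) O
splits-inv G (c , c′) = c′ , c

distinguishes-inv : (P Q : SepSet n) (s : Pair n) → Distinguishes s P Q → Distinguishes (inv s) P Q
distinguishes-inv _ _ _ (inj₁ (p , q)) = inj₂ (q , p)
distinguishes-inv _ _ _ (inj₂ (p , q)) = inj₁ (q , p)

distinguishes⇒between : (P Q : SepSet n) (s : Pair n) → Distinguishes s P Q →
  (s ∈ P × inv s ∈ Q) ⊎ (inv s ∈ P × s ∈ Q)
distinguishes⇒between _ _ _ (inj₁ ((s∈P , _) , (inv-s∈Q , _))) = inj₁ (s∈P , inv-s∈Q)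
distinguishes⇒between _ _ _ (inj₂ ((s∈Q , _) , (inv-s∈P , _))) = inj₂ (inv-s∈P , s∈Q)

module _ {G : Graph n} where

  profile-antisymmetric : {P : SepSet n} → IsProfile G P → Antisymmetric P
  profile-antisymmetric P-profile s∈P = consistent s∈P (separations s∈P) ≼-refl
    where open IsProfile P-profile

  between⇒distinguishes : {P Q : SepSet n} {s : Pair n} → IsProfile G P → IsProfile G Q →
    s ∈ P → inv s ∈ Q → Distinguishes s P Q
  between⇒distinguishes P-profile Q-profile s∈P inv-s∈Q =
    inj₁ ((s∈P , λ s∈Q → profile-antisymmetric Q-profile s∈Q inv-s∈Q) ,
          (inv-s∈Q , profile-antisymmetric P-profile s∈P))

  -- An improper separation is comparable with its inverse, and consistency keeps the larger of the
  -- two out of every profile; here one profile contains `s` and another `inv s`.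
  between⇒proper : {P Q : SepSet n} {s : Pair n} → IsProfile G P → IsProfile G Q →
    s ∈ P → inv s ∈ Q → s ∈ Proper
  between⇒proper {s = s} P-profile Q-profile s∈P inv-s∈Q =
    (λ A⊆B → IsProfile.consistent Q-profile inv-s∈Q sep-s (A⊆B , A⊆B) inv-s∈Q) ,
    (λ B⊆A → IsProfile.consistent P-profile s∈P (separation-inv G sep-s) (B⊆A , B⊆A) s∈P)
    where sep-s = IsProfile.separations P-profile s∈P

-- Tasks

module _ {G : Graph n} {S : SepSet n} {𝒫 : Family n} (task : IsTask G S 𝒫) where
  open IsTask task
  open IsSystem isSystem

  task-orients : ∀ i {s} → s ∈ S → s ∈ 𝒫 at i ⊎ inv s ∈ 𝒫 at i
  task-orients i s∈S = Sum.map₂ proj₁ (proj₂ (orients i) s∈S)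

  -- Makes feasibility survive restriction: the `e` above `s ∨ t` that `feasible` provides for two
  -- profiles also distinguishes them, so it stays in any subset that keeps the distinguishing
  -- separations.
  inv-above : ∀ j {s e} → s ∈ S → e ∈ S → s ≼ e → inv s ∈ 𝒫 at j → inv e ∈ 𝒫 at j
  inv-above j s∈S e∈S s≼e inv-s∈Pj with task-orients j e∈S
  ... | inj₂ inv-e∈Pj = inv-e∈Pj
  ... | inj₁ e∈Pj =
        contradiction inv-s∈Pj (IsProfile.consistent (profiles j) e∈Pj (separations s∈S) s≼e)

  -- Both reductions and the tasks (S_O , 𝒫_O) are restrictions in this sense.
  feasible-restriction : {S′ : SepSet n} {I : Set} (ι : I → 𝒫 .Index) → let 𝒫′ = family I (λ i → 𝒫 at ι i) in
    S′ ⊆ S → (∀ {s} → s ∈ S′ → inv s ∈ S′) →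
    (∀ i j {s} → s ∈ S → s ∈ 𝒫′ at i → inv s ∈ 𝒫′ at j → s ∈ S′) →
    IsFeasible G S 𝒫 → IsFeasible G S′ 𝒫′
  feasible-restriction {S′} ι S′⊆S inv-closed′ between∈S′ feas = record
    { isTask = record
      { isSystem = record { separations = separations ∘ S′⊆S ; inv-closed = inv-closed′ }
      ; proper = proper ∘ S′⊆S
      ; profiles = profiles ∘ ι
      ; orients = λ i → proj₁ (orients (ι i)) , λ s∈S′ →
          Sum.map₂ (λ inv-s∈P → inv-s∈P , inv-closed′ s∈S′) (task-orients (ι i) (S′⊆S s∈S′))
      ; distinguishes = λ i j i≢j → let (s , s∈S , d) = distinguishes (ι i) (ι j) i≢j in
          s , distinguishing∈S′ i j s∈S (distinguishes⇒between (𝒫 at ι i) (𝒫 at ι j) s d) , d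
      }
    ; feasible = λ s∈S′ t∈S′ s×t i j s∈P t∈P inv-s∈P′ inv-t∈P′ →
        let (e , (e∈P , e∈S) , s∨t≼e) =
              IsFeasible.feasible feas (S′⊆S s∈S′) (S′⊆S t∈S′) s×t (ι i) (ι j) s∈P t∈P inv-s∈P′ inv-t∈P′
            inv-e∈P′ = inv-above (ι j) (S′⊆S s∈S′) e∈S (≼-trans (∨-upperˡ _ _) s∨t≼e) inv-s∈P′
        in e , (e∈P , between∈S′ i j e∈S e∈P inv-e∈P′) , s∨t≼e
    }
    where
    distinguishing∈S′ : ∀ i j {s} → s ∈ S →
      (s ∈ 𝒫 at ι i × inv s ∈ 𝒫 at ι j) ⊎ (inv s ∈ 𝒫 at ι i × s ∈ 𝒫 at ι j) → s ∈ S′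
    distinguishing∈S′ i j s∈S (inj₁ (s∈P , inv-s∈P′)) = between∈S′ i j s∈S s∈P inv-s∈P′
    distinguishing∈S′ i j s∈S (inj₂ (inv-s∈P , s∈P′)) = between∈S′ j i s∈S s∈P′ inv-s∈P

module _ {G : Graph n} {S : SepSet n} {𝒫 : Family n} (feas : IsFeasible G S 𝒫) where
  open IsFeasible feas
  open IsTask isTask
  open IsSystem isSystem

  reduction-feasible : IsFeasible G (reduction S 𝒫) 𝒫
  reduction-feasible = feasible-restriction isTask id proj₁
    (λ {s} (s∈S , i , j , d) → inv-closed s∈S , i , j , distinguishes-inv (𝒫 at i) (𝒫 at j) s d)
    (λ i j s∈S s∈P inv-s∈P′ →
      s∈S , i , j , between⇒distinguishes (profiles i) (profiles j) s∈P inv-s∈P′)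
    feas

  split-feasible : (N O : SepSet n) → IsFeasible G (splitBy G S O) (inducing 𝒫 N O)
  split-feasible N O = feasible-restriction isTask proj₁ proj₁
    (λ (s∈S , s-splits) → inv-closed s∈S , splits-inv G s-splits)
    (λ (i , (_ , O⊆Pi)) (j , (_ , O⊆Pj)) s∈S s∈P inv-s∈P′ →
      s∈S , between⇒splits G (IsProfile.consistent (profiles i)) (IsProfile.consistent (profiles j))
              (proj₁ ∘ O⊆Pi) (proj₁ ∘ O⊆Pj) s∈P inv-s∈P′)
    feas

-- Operations

-- An index of `inducing 𝒫 N O` contains a proof that the profile induces `O`, so a finite type of
-- indices does not evidently stay finite. As `Q` depends on the member and not on its index, the
-- search can be done in `𝒫` with `P ∩ N ≐ O` as a further conjunct.
record Finitary (𝒫 : Family n) : Set₁ where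
  field
    member? : ∀ i → Decidable (𝒫 at i)
    find    : (Q : SepSet n → Set) → (∀ i → Dec (Q (𝒫 at i))) → Dec (∃[ i ] Q (𝒫 at i))

open Finitary

distinguishesSomeTwo? : {𝒫 : Family n} → Finitary 𝒫 → Decidable (DistinguishesSomeTwo 𝒫)
distinguishesSomeTwo? {𝒫 = 𝒫} fin s =
  find fin (λ P → ∃[ j ] Distinguishes s P (𝒫 at j)) λ i →
  find fin (λ P → Distinguishes s (𝒫 at i) P) λ j →
  distinguishes? (member? fin i) (member? fin j) s

reduction? : {S : SepSet n} {𝒫 : Family n} → Decidable S → Finitary 𝒫 → Decidable (reduction S 𝒫)
reduction? S? fin = S? ∩? distinguishesSomeTwo? fin

locallyMaximal? : {S : SepSet n} {𝒫 : Family n} → Decidable S → Finitary 𝒫 → Decidable (LocallyMaximal S 𝒫)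
locallyMaximal? {S = S} S? fin s =
  find fin (λ P → WellSeparated P S × s ∈ Maximal (P ∩ S)) λ i →
  nestedSet? (maximal? (member? fin i ∩? S?)) ×-dec maximal? (member? fin i ∩? S?) s

withInverses? : {X : SepSet n} → Decidable X → Decidable (withInverses X)
withInverses? X? s = X? s ⊎-dec X? (inv s)

operation? : ∀ o {S : SepSet n} {𝒫 : Family n} → Decidable S → Finitary 𝒫 → Decidable (⟦ o ⟧ S 𝒫)
operation? ext  S? fin = withInverses? (extremal? S?)
operation? loc  S? fin = withInverses? (locallyMaximal? S? fin)
operation? all  S? fin = S? ∩? nestedWith? S?
operation? extᵣ S? fin = operation? ext (reduction? S? fin) fin
operation? locᵣ S? fin = operation? loc (reduction? S? fin) fin
operation? allᵣ S? fin = operation? all (reduction? S? fin) fin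

isReducing? : Decidable IsReducing
isReducing? ext  = no λ ()
isReducing? loc  = no λ ()
isReducing? all  = no λ ()
isReducing? extᵣ = yes extᵣ
isReducing? locᵣ = yes locᵣ
isReducing? allᵣ = yes allᵣ

withInverses-⊆ : (X {S} : SepSet n) → (∀ {s} → s ∈ S → inv s ∈ S) → X ⊆ S → withInverses X ⊆ S
withInverses-⊆ X S-inv X⊆S (inj₁ s∈X)     = X⊆S s∈X
withInverses-⊆ X S-inv X⊆S (inj₂ inv-s∈X) = S-inv (X⊆S inv-s∈X)

withInverses-nested : (X {S} : SepSet n) → X ⊆ NestedWith S → withInverses X ⊆ NestedWith S
withInverses-nested X X∥S (inj₁ s∈X)     t∈S = X∥S s∈X t∈S
withInverses-nested X X∥S (inj₂ inv-s∈X) t∈S = nested-invˡ (X∥S inv-s∈X t∈S)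

extremal-nested : {S : SepSet n} → Extremal S ⊆ NestedWith S
extremal-nested (_ , above) t∈S with above t∈S
... | inj₁ t≼s     = inj₁ (inj₂ t≼s)
... | inj₂ inv-t≼s = inj₂ (inj₂ inv-t≼s)

module _ {G : Graph n} {S : SepSet n} {𝒫 : Family n} (feas : IsFeasible G S 𝒫) where
  open IsFeasible feas
  open IsTask isTask
  open IsSystem isSystem

  reduction-inv : ∀ {s} → s ∈ reduction S 𝒫 → inv s ∈ reduction S 𝒫
  reduction-inv = IsSystem.inv-closed (IsTask.isSystem (IsFeasible.isTask (reduction-feasible feas)))

  operation-⊆ : ∀ o → ⟦ o ⟧ S 𝒫 ⊆ S
  operation-⊆ ext  = withInverses-⊆ (Extremal S) inv-closed proj₁
  operation-⊆ loc  = withInverses-⊆ (LocallyMaximal S 𝒫) inv-closed (λ (_ , _ , (_ , s∈S) , _) → s∈S)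
  operation-⊆ all  = proj₁
  operation-⊆ extᵣ = proj₁ ∘ withInverses-⊆ (Extremal (reduction S 𝒫)) reduction-inv proj₁
  operation-⊆ locᵣ = proj₁ ∘ withInverses-⊆ (LocallyMaximal (reduction S 𝒫) 𝒫) reduction-inv
    (λ (_ , _ , (_ , s∈R) , _) → s∈R)
  operation-⊆ allᵣ = proj₁ ∘ proj₁

  operation-reduction : ∀ {o} → IsReducing o → ⟦ o ⟧ S 𝒫 ⊆ reduction S 𝒫
  operation-reduction extᵣ = withInverses-⊆ (Extremal (reduction S 𝒫)) reduction-inv proj₁
  operation-reduction locᵣ = withInverses-⊆ (LocallyMaximal (reduction S 𝒫) 𝒫) reduction-inv
    (λ (_ , _ , (_ , s∈R) , _) → s∈R)
  operation-reduction allᵣ = proj₁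

  operation-inv : ∀ o {s} → s ∈ ⟦ o ⟧ S 𝒫 → inv s ∈ ⟦ o ⟧ S 𝒫
  operation-inv ext  = Sum.swap
  operation-inv loc  = Sum.swap
  operation-inv all  (s∈S , s∥S) = inv-closed s∈S , λ t∈S → nested-invˡ (s∥S t∈S)
  operation-inv extᵣ = Sum.swap
  operation-inv locᵣ = Sum.swap
  operation-inv allᵣ (s∈R , s∥R) = reduction-inv s∈R , λ t∈R → nested-invˡ (s∥R t∈R)

  -- Each `t` in `S` has an orientation in the profile, and this lies below some maximal `t′`, which
  -- is nested with `s`. Of the four ways to be nested, `inv t′ ≼ s` contradicts consistency; the
  -- others pass to what lies below `t′`, as `s ≼ t′` makes `s` and `t′` equal.
  maximal-nested : Decidable S → ∀ i → Decidable (𝒫 at i) → WellSeparated (𝒫 at i) S →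
    Maximal (𝒫 at i ∩ S) ⊆ NestedWith S
  maximal-nested S? i P? separated {s} s-max@((s∈P , s∈S) , s-top) {t} t∈S =
    Sum.[ (λ t∈P → below t∈P t∈S) , (λ t*∈P → nested-invʳ (below t*∈P (inv-closed t∈S))) ]
      (task-orients isTask i t∈S)
    where
    below : ∀ {t} → t ∈ 𝒫 at i → t ∈ S → Nested s t
    below t∈P t∈S with maximal-above (P? ∩? S?) (t∈P , t∈S)
    ... | t′ , t≼t′ , t′-max@((t′∈P , t′∈S) , t′-top) with separated s-max t′-max
    ...   | inj₁ (inj₁ s≼t′) = inj₁ (inj₂ (subst (_ ≼_) (s-top (t′∈P , t′∈S) s≼t′) t≼t′))
    ...   | inj₁ (inj₂ t′≼s) = inj₁ (inj₂ (≼-trans t≼t′ t′≼s))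
    ...   | inj₂ (inj₁ s≼t′*) = inj₂ (inj₁ (≼-trans s≼t′* (inv-anti t≼t′)))
    ...   | inj₂ (inj₂ t′*≼s) = contradiction t′∈P
            (IsProfile.consistent (profiles i) s∈P (separations (inv-closed t′∈S)) t′*≼s)

  ext-nested : ⟦ ext ⟧ S 𝒫 ⊆ NestedWith S
  ext-nested = withInverses-nested (Extremal S) extremal-nested

  loc-nested : Decidable S → Finitary 𝒫 → ⟦ loc ⟧ S 𝒫 ⊆ NestedWith S
  loc-nested S? fin = withInverses-nested (LocallyMaximal S 𝒫) λ (i , separated , s-max) →
    maximal-nested S? i (member? fin i) separated s-max

  module _ (reduced : S ⊆ DistinguishesSomeTwo 𝒫) where

    contained : ∀ {s} → s ∈ S → ∃[ i ] s ∈ 𝒫 at i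
    contained s∈S with reduced s∈S
    ... | i , j , inj₁ ((s∈P , _) , _) = i , s∈P
    ... | i , j , inj₂ ((s∈P , _) , _) = j , s∈P

    maximal⇒extremal : ∀ {s} → s ∈ Maximal S → s ∈ Extremal S
    maximal⇒extremal {s} (s∈S , s-top) = s∈S , above
      where
      top : ∀ {t} → t ∈ S → Cross s t → ∀ i j →
            s ∈ 𝒫 at i → t ∈ 𝒫 at i → inv s ∈ 𝒫 at j → inv t ∈ 𝒫 at j → t ≼ s
      top {t} t∈S s×t i j s∈P t∈P s*∈P′ t*∈P′ with feasible s∈S t∈S s×t i j s∈P t∈P s*∈P′ t*∈P′
      ... | e , (_ , e∈S) , s∨t≼e =
            subst (t ≼_) (s-top e∈S (≼-trans (∨-upperˡ s t) s∨t≼e)) (≼-trans (∨-upperʳ s t) s∨t≼e)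

      i = proj₁ (contained s∈S)
      s∈Pi = proj₂ (contained s∈S)
      j = proj₁ (contained (inv-closed s∈S))
      s*∈Pj = proj₂ (contained (inv-closed s∈S))

      -- Feasibility needs two profiles that orient both separations oppositely, and the profiles
      -- `i` and `j` orient `t` alike. As `S` is reduced, some profile `l` contains `inv t`; it is
      -- paired with whichever of the two orients `s` differently from `l`.
      agreeing : ∀ {t} → t ∈ S → Cross s t → t ∈ 𝒫 at i → t ∈ 𝒫 at j → t ≼ s ⊎ inv t ≼ s
      agreeing {t} t∈S s×t t∈Pi t∈Pj with contained (inv-closed t∈S)
      ... | l , t*∈Pl with task-orients isTask l s∈S
      ...   | inj₁ s∈Pl  = inj₂ (top (inv-closed t∈S) (s×t ∘ nested-invʳ) l j s∈Pl t*∈Pl s*∈Pj t∈Pj)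
      ...   | inj₂ s*∈Pl = inj₁ (top t∈S s×t i l s∈Pi t∈Pi s*∈Pl t*∈Pl)

      crossing : ∀ {t} → t ∈ S → Cross s t → t ≼ s ⊎ inv t ≼ s
      crossing t∈S s×t with task-orients isTask i t∈S | task-orients isTask j t∈S
      ... | inj₁ t∈Pi  | inj₁ t∈Pj  = agreeing t∈S s×t t∈Pi t∈Pj
      ... | inj₁ t∈Pi  | inj₂ t*∈Pj = inj₁ (top t∈S s×t i j s∈Pi t∈Pi s*∈Pj t*∈Pj)
      ... | inj₂ t*∈Pi | inj₁ t∈Pj  =
            inj₂ (top (inv-closed t∈S) (s×t ∘ nested-invʳ) i j s∈Pi t*∈Pi s*∈Pj t∈Pj)
      ... | inj₂ t*∈Pi | inj₂ t*∈Pj =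
            Sum.swap (agreeing (inv-closed t∈S) (s×t ∘ nested-invʳ) t*∈Pi t*∈Pj)

      above : ∀ {t} → t ∈ S → t ≼ s ⊎ inv t ≼ s
      above {t} t∈S with nested? s t
      ... | yes (inj₁ (inj₁ s≼t))  = inj₁ (subst (t ≼_) (s-top t∈S s≼t) ≼-refl)
      ... | yes (inj₁ (inj₂ t≼s))  = inj₁ t≼s
      ... | yes (inj₂ (inj₁ s≼t*)) = inj₂ (subst (inv t ≼_) (s-top (inv-closed t∈S) s≼t*) ≼-refl)
      ... | yes (inj₂ (inj₂ t*≼s)) = inj₂ t*≼s
      ... | no s×t = crossing t∈S s×t

    -- In a profile containing the extremal `s`, a maximal element is below `s`, hence equal to it,
    -- or has its inverse below `s`, against consistency. A single maximal element is trivially well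
    -- separated.
    extremal⇒locallyMaximal : Extremal S ⊆ LocallyMaximal S 𝒫
    extremal⇒locallyMaximal {s} (s∈S , above) with contained s∈S
    ... | i , s∈P = i , separated , (s∈P , s∈S) , top
      where
      top : ∀ {t} → t ∈ 𝒫 at i ∩ S → s ≼ t → t ≡ s
      top (t∈P , t∈S) s≼t with above t∈S
      ... | inj₁ t≼s  = ≼-antisym t≼s s≼t
      ... | inj₂ t*≼s = ⊥-elim (proj₂ (proper t∈S) (proj₂ (≼-trans t*≼s s≼t)))

      unique : ∀ {t} → t ∈ Maximal (𝒫 at i ∩ S) → t ≡ s
      unique ((t∈P , t∈S) , t-top) with above t∈S
      ... | inj₁ t≼s  = sym (t-top (s∈P , s∈S) t≼s)
      ... | inj₂ t*≼s = contradiction t∈P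
            (IsProfile.consistent (profiles i) s∈P (separations (inv-closed t∈S)) t*≼s)

      separated : WellSeparated (𝒫 at i) S
      separated u-max v-max with refl ← unique u-max | refl ← unique v-max = inj₁ (inj₁ ≼-refl)

    extremal-exists : Decidable S → ∀ {x} → x ∈ S → ∃ (Extremal S)
    extremal-exists S? x∈S with maximal-above S? x∈S
    ... | s , _ , s-max = s , maximal⇒extremal s-max

module _ {G : Graph n} {S : SepSet n} {𝒫 : Family n} (feas : IsFeasible G S 𝒫)
         (S? : Decidable S) (fin : Finitary 𝒫) where

  private
    reduced = reduction-feasible feas
    R? = reduction? S? fin

  operation-nested : ∀ o → (IsReducing o → S ⊆ reduction S 𝒫) → ⟦ o ⟧ S 𝒫 ⊆ NestedWith S
  operation-nested ext  _   s∈N t∈S = ext-nested feas s∈N t∈S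
  operation-nested loc  _   s∈N t∈S = loc-nested feas S? fin s∈N t∈S
  operation-nested all  _   (_ , s∥S) t∈S = s∥S t∈S
  operation-nested extᵣ S⊆R s∈N t∈S = ext-nested reduced s∈N (S⊆R extᵣ t∈S)
  operation-nested locᵣ S⊆R s∈N t∈S = loc-nested reduced R? fin s∈N (S⊆R locᵣ t∈S)
  operation-nested allᵣ S⊆R (_ , s∥R) t∈S = s∥R (S⊆R allᵣ t∈S)

  -- One extremal separation of the reduction serves all three operations, being locally maximal and
  -- nested with the whole reduction.
  operation-nonempty : ∀ {o} → IsReducing o → ∀ {x} → x ∈ reduction S 𝒫 → ∃ (⟦ o ⟧ S 𝒫)
  operation-nonempty red x∈R with extremal-exists reduced proj₂ R? x∈R
  operation-nonempty extᵣ x∈R | s , s-ext = s , inj₁ s-ext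
  operation-nonempty locᵣ x∈R | s , s-ext = s , inj₁ (extremal⇒locallyMaximal reduced proj₂ s-ext)
  operation-nonempty allᵣ x∈R | s , s-ext = s , proj₁ s-ext , extremal-nested s-ext

  operation-system : ∀ o → (IsReducing o → S ⊆ reduction S 𝒫) → IsNestedSystem G (⟦ o ⟧ S 𝒫)
  operation-system o S⊆R = record
    { isSystem = record
      { separations = IsSystem.separations (IsTask.isSystem (IsFeasible.isTask feas)) ∘ operation-⊆ feas o
      ; inv-closed = operation-inv feas o }
    ; nested = λ s∈N t∈N → operation-nested o S⊆R s∈N (operation-⊆ feas o t∈N) }

-- Transport along isomorphisms

-- Both directions are part of the data, so that a transport can be inverted: the invariances below
-- are proved as one implication, and `inverse` supplies the other. Under `identity` the same lemmas
-- express invariance under `≐`.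
record Transport {n n′} (G : Graph n) (G′ : Graph n′) : Set where
  field
    toᵛ        : Subset n → Subset n′
    fromᵛ      : Subset n′ → Subset n
    from-toᵛ   : ∀ A → fromᵛ (toᵛ A) ≡ A
    to-fromᵛ   : ∀ A → toᵛ (fromᵛ A) ≡ A
    toᵛ-mono   : ∀ {A B} → A V.⊆ B → toᵛ A V.⊆ toᵛ B
    fromᵛ-mono : ∀ {A B} → A V.⊆ B → fromᵛ A V.⊆ fromᵛ B

  to : Pair n → Pair n′
  to (A , B) = toᵛ A , toᵛ B

  from : Pair n′ → Pair n
  from (A , B) = fromᵛ A , fromᵛ B

  field
    to-separation   : ∀ {s} → s ∈ IsSeparation G → to s ∈ IsSeparation G′
    from-separation : ∀ {s} → s ∈ IsSeparation G′ → from s ∈ IsSeparation G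
    order-to        : ∀ s → order (to s) ≡ order s
    order-from      : ∀ s → order (from s) ≡ order s

  from-to : ∀ s → from (to s) ≡ s
  from-to (A , B) = cong₂ _,_ (from-toᵛ A) (from-toᵛ B)

  to-from : ∀ s → to (from s) ≡ s
  to-from (A , B) = cong₂ _,_ (to-fromᵛ A) (to-fromᵛ B)

  to-mono : ∀ {s t} → s ≼ t → to s ≼ to t
  to-mono (a , b) = toᵛ-mono a , toᵛ-mono b

  from-≼⇒≼-to : ∀ {s t} → from t ≼ s → t ≼ to s
  from-≼⇒≼-to {s} {t} t≼s = subst (_≼ to s) (to-from t) (to-mono t≼s)

  ≼-from⇒to-≼ : ∀ {s t} → s ≼ from t → to s ≼ t
  ≼-from⇒to-≼ {s} {t} s≼t = subst (to s ≼_) (to-from t) (to-mono s≼t)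

  nested-from⇒nested-to : ∀ {s t} → Nested s (from t) → Nested (to s) t
  nested-from⇒nested-to (inj₁ (inj₁ p)) = inj₁ (inj₁ (≼-from⇒to-≼ p))
  nested-from⇒nested-to (inj₁ (inj₂ p)) = inj₁ (inj₂ (from-≼⇒≼-to p))
  nested-from⇒nested-to (inj₂ (inj₁ p)) = inj₂ (inj₁ (≼-from⇒to-≼ p))
  nested-from⇒nested-to (inj₂ (inj₂ p)) = inj₂ (inj₂ (from-≼⇒≼-to p))

private variable
  G : Graph n
  G′ : Graph n′

open Transport

inverse : Transport G G′ → Transport G′ G
inverse T = record
  { toᵛ = fromᵛ T ; fromᵛ = toᵛ T ; from-toᵛ = to-fromᵛ T ; to-fromᵛ = from-toᵛ T
  ; toᵛ-mono = fromᵛ-mono T ; fromᵛ-mono = toᵛ-mono T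
  ; to-separation = from-separation T ; from-separation = to-separation T
  ; order-to = order-from T ; order-from = order-to T }

identity : Transport G G
identity = record
  { toᵛ = id ; fromᵛ = id ; from-toᵛ = λ _ → refl ; to-fromᵛ = λ _ → refl
  ; toᵛ-mono = λ p → p ; fromᵛ-mono = λ p → p
  ; to-separation = id ; from-separation = id
  ; order-to = λ _ → refl ; order-from = λ _ → refl }

infix 4 _∼[_]_ _∼ᶠ[_]_

record _∼[_]_ (S : SepSet n) (T : Transport {n} {n′} G G′) (S′ : SepSet n′) : Set where
  constructor corr
  field
    to∈   : ∀ {s} → s ∈ S → to T s ∈ S′
    from∈ : ∀ {s} → s ∈ S′ → from T s ∈ S

  reflect∈ : ∀ {s} → to T s ∈ S′ → s ∈ S
  reflect∈ {s} = subst S (from-to T s) ∘ from∈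

  to∈⁻ : ∀ {s} → from T s ∈ S → s ∈ S′
  to∈⁻ {s} = subst S′ (to-from T s) ∘ to∈

open _∼[_]_

record _∼ᶠ[_]_ (𝒫 : Family n) (T : Transport {n} {n′} G G′) (𝒫′ : Family n′) : Set where
  constructor corrᶠ
  field
    toᶠ   : ∀ i → ∃[ j ] 𝒫 at i ∼[ T ] 𝒫′ at j
    fromᶠ : ∀ j → ∃[ i ] 𝒫 at i ∼[ T ] 𝒫′ at j

open _∼ᶠ[_]_

private variable
  T : Transport {n} {n′} G G′
  S N O P Q : SepSet n
  S′ N′ O′ P′ Q′ : SepSet n′
  𝒫 : Family n
  𝒫′ : Family n′

∼-inverse : S ∼[ T ] S′ → S′ ∼[ inverse T ] S
∼-inverse c = corr (from∈ c) (to∈ c)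

∼ᶠ-inverse : 𝒫 ∼ᶠ[ T ] 𝒫′ → 𝒫′ ∼ᶠ[ inverse T ] 𝒫
∼ᶠ-inverse f = corrᶠ (λ j → let (i , c) = fromᶠ f j in i , ∼-inverse c)
                     (λ i → let (j , c) = toᶠ f i in j , ∼-inverse c)

∼-refl : S ∼[ identity {G = G} ] S
∼-refl = corr id id

∼ᶠ-refl : 𝒫 ∼ᶠ[ identity {G = G} ] 𝒫
∼ᶠ-refl = corrᶠ (λ i → i , ∼-refl) (λ i → i , ∼-refl)

≐⇒∼ : S ≐ N → S ∼[ identity {G = G} ] N
≐⇒∼ (S⊆N , N⊆S) = corr S⊆N N⊆S

∼-image : (T : Transport G G′) → O ∼[ T ] (λ s → from T s ∈ O)
∼-image {O = O} T = corr (λ {s} → subst O (sym (from-to T s))) id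

∼-∩ : P ∼[ T ] P′ → Q ∼[ T ] Q′ → P ∩ Q ∼[ T ] P′ ∩ Q′
∼-∩ c d = corr (λ (p , q) → to∈ c p , to∈ d q) (λ (p , q) → from∈ c p , from∈ d q)

∼-∖ : P ∼[ T ] P′ → Q ∼[ T ] Q′ → P ∖ Q ∼[ T ] P′ ∖ Q′
∼-∖ c d = corr (λ (p , q) → to∈ c p , q ∘ reflect∈ d) (λ (p , q) → from∈ c p , q ∘ to∈⁻ d)

∼-∪-singleton : ∀ {s} → O ∼[ T ] O′ → O ∪ ｛ s ｝ ∼[ T ] O′ ∪ ｛ to T s ｝
∼-∪-singleton {T = T} {s = s} c = corr
  (λ { (inj₁ o) → inj₁ (to∈ c o) ; (inj₂ refl) → inj₂ refl })
  (λ { (inj₁ o) → inj₁ (from∈ c o) ; (inj₂ refl) → inj₂ (sym (from-to T s)) })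

∼-⊆ : P ∼[ T ] P′ → Q ∼[ T ] Q′ → P ⊆ Q → P′ ⊆ Q′
∼-⊆ c d P⊆Q p = to∈⁻ d (P⊆Q (from∈ c p))

∼-⊂ : P ∼[ T ] P′ → Q ∼[ T ] Q′ → P ⊂ Q → P′ ⊂ Q′
∼-⊂ c d (P⊆Q , Q⊈P) = ∼-⊆ c d P⊆Q , λ Q′⊆P′ → Q⊈P (∼-⊆ (∼-inverse d) (∼-inverse c) Q′⊆P′)

∼-≐ : P ∼[ T ] P′ → Q ∼[ T ] Q′ → P ≐ Q → P′ ≐ Q′
∼-≐ c d (P⊆Q , Q⊆P) = ∼-⊆ c d P⊆Q , ∼-⊆ d c Q⊆P

∼-empty : S ∼[ T ] S′ → Empty S → Empty S′
∼-empty {T = T} c S-empty s s∈S′ = S-empty (from T s) (from∈ c s∈S′)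

to-distinguishes : ∀ {s} → P ∼[ T ] P′ → Q ∼[ T ] Q′ → Distinguishes s P Q → Distinguishes (to T s) P′ Q′
to-distinguishes c d (inj₁ (p , q)) = inj₁ (to∈ (∼-∖ c d) p , to∈ (∼-∖ d c) q)
to-distinguishes c d (inj₂ (q , p)) = inj₂ (to∈ (∼-∖ d c) q , to∈ (∼-∖ c d) p)

to-reduction : S ∼[ T ] S′ → 𝒫 ∼ᶠ[ T ] 𝒫′ → ∀ {s} → s ∈ reduction S 𝒫 → to T s ∈ reduction S′ 𝒫′
to-reduction c f (s∈S , i , j , d) =
  to∈ c s∈S , _ , _ , to-distinguishes (proj₂ (toᶠ f i)) (proj₂ (toᶠ f j)) d

∼-reduction : S ∼[ T ] S′ → 𝒫 ∼ᶠ[ T ] 𝒫′ → reduction S 𝒫 ∼[ T ] reduction S′ 𝒫′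
∼-reduction c f = corr (to-reduction c f) (to-reduction (∼-inverse c) (∼ᶠ-inverse f))

to-nestedWith : S ∼[ T ] S′ → ∀ {s} → s ∈ NestedWith S → to T s ∈ NestedWith S′
to-nestedWith {T = T} c s∥S t∈S′ = nested-from⇒nested-to T (s∥S (from∈ c t∈S′))

to-nestedSet : S ∼[ T ] S′ → NestedSet S → NestedSet S′
to-nestedSet {T = T} c S-nested {s} {t} s∈S′ t∈S′ = subst (λ x → Nested x t) (to-from T s)
  (nested-from⇒nested-to T (S-nested (from∈ c s∈S′) (from∈ c t∈S′)))

to-extremal : S ∼[ T ] S′ → ∀ {s} → s ∈ Extremal S → to T s ∈ Extremal S′
to-extremal {T = T} c (s∈S , above) = to∈ c s∈S , λ t∈S′ →
  Sum.map (from-≼⇒≼-to T) (from-≼⇒≼-to T) (above (from∈ c t∈S′))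

to-maximal : S ∼[ T ] S′ → ∀ {s} → s ∈ Maximal S → to T s ∈ Maximal S′
to-maximal {T = T} c (s∈S , top) = to∈ c s∈S , λ {t} t∈S′ s≼t →
  trans (sym (to-from T t)) (cong (to T) (top (from∈ c t∈S′) (from-≼⇒≼-to (inverse T) s≼t)))

∼-maximal : S ∼[ T ] S′ → Maximal S ∼[ T ] Maximal S′
∼-maximal c = corr (to-maximal c) (to-maximal (∼-inverse c))

to-locallyMaximal : S ∼[ T ] S′ → 𝒫 ∼ᶠ[ T ] 𝒫′ →
  ∀ {s} → s ∈ LocallyMaximal S 𝒫 → to T s ∈ LocallyMaximal S′ 𝒫′
to-locallyMaximal c f (i , separated , s-max) with toᶠ f i
... | j , d = j , to-nestedSet (∼-maximal (∼-∩ d c)) separated , to-maximal (∼-∩ d c) s-max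

to-operation : ∀ o → S ∼[ T ] S′ → 𝒫 ∼ᶠ[ T ] 𝒫′ → ∀ {s} → s ∈ ⟦ o ⟧ S 𝒫 → to T s ∈ ⟦ o ⟧ S′ 𝒫′
to-operation ext  c f = Sum.map (to-extremal c) (to-extremal c)
to-operation loc  c f = Sum.map (to-locallyMaximal c f) (to-locallyMaximal c f)
to-operation all  c f (s∈S , s∥S) = to∈ c s∈S , to-nestedWith c s∥S
to-operation extᵣ c f = to-operation ext (∼-reduction c f) f
to-operation locᵣ c f = to-operation loc (∼-reduction c f) f
to-operation allᵣ c f = to-operation all (∼-reduction c f) f

∼-operation : ∀ o → S ∼[ T ] S′ → 𝒫 ∼ᶠ[ T ] 𝒫′ → ⟦ o ⟧ S 𝒫 ∼[ T ] ⟦ o ⟧ S′ 𝒫′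
∼-operation o c f = corr (to-operation o c f) (to-operation o (∼-inverse c) (∼ᶠ-inverse f))

to-consistent : {T : Transport G G′} → P ∼[ T ] P′ → Consistent G P → Consistent G′ P′
to-consistent {T = T} c consistent s∈P′ sep t≼s inv-t∈P′ =
  consistent (from∈ c s∈P′) (from-separation T sep) (to-mono (inverse T) t≼s) (from∈ c inv-t∈P′)

to-orients : P ∼[ T ] P′ → S ∼[ T ] S′ → Orients P S → Orients P′ S′
to-orients c d (antisymmetric , orient) =
  (λ s∈P′ inv-s∈P′ → antisymmetric (from∈ c s∈P′) (from∈ c inv-s∈P′)) ,
  (λ s∈S′ → Sum.map (to∈⁻ c) (to∈⁻ (∼-∩ c d)) (orient (from∈ d s∈S′)))

to-𝒪 : {T : Transport G G′} → N ∼[ T ] N′ → O ∼[ T ] O′ → O ∈ 𝒪 G N → O′ ∈ 𝒪 G′ N′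
to-𝒪 c d (O⊆N , orients , consistent) = ∼-⊆ d c O⊆N , to-orients d c orients , to-consistent d consistent

to-splits : {T : Transport G G′} → O ∼[ T ] O′ → ∀ {s} → Splits G s O → Splits G′ (to T s) O′
to-splits c (consistent , consistent′) =
  to-consistent (∼-∪-singleton c) consistent , to-consistent (∼-∪-singleton c) consistent′

to-splitBy : {T : Transport G G′} → S ∼[ T ] S′ → O ∼[ T ] O′ →
  ∀ {s} → s ∈ splitBy G S O → to T s ∈ splitBy G′ S′ O′
to-splitBy c d (s∈S , splits) = to∈ c s∈S , to-splits d splits

∼-splitBy : {T : Transport G G′} → S ∼[ T ] S′ → O ∼[ T ] O′ → splitBy G S O ∼[ T ] splitBy G′ S′ O′
∼-splitBy c d = corr (to-splitBy c d) (to-splitBy (∼-inverse c) (∼-inverse d))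

∼ᶠ-inducing : 𝒫 ∼ᶠ[ T ] 𝒫′ → N ∼[ T ] N′ → O ∼[ T ] O′ → inducing 𝒫 N O ∼ᶠ[ T ] inducing 𝒫′ N′ O′
∼ᶠ-inducing f c d = corrᶠ
  (λ (i , p) → let (j , e) = toᶠ f i in (j , ∼-≐ (∼-∩ e c) d p) , e)
  (λ (j , p) → let (i , e) = fromᶠ f j in
    (i , ∼-≐ (∼-∩ (∼-inverse e) (∼-inverse c)) (∼-inverse d) p) , e)

∼ᶠ-restrict : (k : ℕ) → 𝒫 ∼ᶠ[ T ] 𝒫′ → restrict k 𝒫 ∼ᶠ[ T ] restrict k 𝒫′
∼ᶠ-restrict {T = T} k f = corrᶠ (λ i → let (j , c) = toᶠ f i in j , ∼-< c)
                                 (λ j → let (i , c) = fromᶠ f j in i , ∼-< c)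
  where
  ∼-< : P ∼[ T ] P′ → (λ s → s ∈ P × order s < k) ∼[ T ] (λ s → s ∈ P′ × order s < k)
  ∼-< c = corr (λ {s} (s∈P , s<k) → to∈ c s∈P , subst (_< k) (sym (order-to T s)) s<k)
               (λ {s} (s∈P , s<k) → from∈ c s∈P , subst (_< k) (sym (order-from T s)) s<k)

to-proper : (T : Transport G G′) → ∀ {s} → s ∈ Proper → to T s ∈ Proper
to-proper T {A , B} (A⊈B , B⊈A) =
  (λ A⊆B → A⊈B (subst₂ V._⊆_ (from-toᵛ T A) (from-toᵛ T B) (fromᵛ-mono T A⊆B))) ,
  (λ B⊆A → B⊈A (subst₂ V._⊆_ (from-toᵛ T B) (from-toᵛ T A) (fromᵛ-mono T B⊆A)))

-- Canonicity

to-assemble : {G : Graph n} {G′ : Graph n′} {T : Transport G G′}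
  (M : SepSet n → SepSet n) (M′ : SepSet n′ → SepSet n′) → N ∼[ T ] N′ →
  (∀ {O} → O ∈ 𝒪 G N → let O′ = λ s → from T s ∈ O in O′ ∈ 𝒪 G′ N′ → ∀ {s} → s ∈ M O → to T s ∈ M′ O′) →
  ∀ {s} → s ∈ assemble G N M → to T s ∈ assemble G′ N′ M′
to-assemble M M′ c f (inj₁ s∈N) = inj₁ (to∈ c s∈N)
to-assemble {T = T} M M′ c f (inj₂ (O , o , s∈MO)) =
  inj₂ (_ , to-𝒪 c (∼-image T) o , f o (to-𝒪 c (∼-image T) o) s∈MO)

-- Induction on both derivations at once. Which constructor applies depends only on what transport
-- preserves, so differently shaped derivations contradict each other, unless an empty `N` leaves
-- nothing to prove. In `step`, an orientation is matched with its preimage under `from`.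
Nσ-to : ∀ {σ} {T : Transport G G′} → Nσ G σ S 𝒫 N → Nσ G′ σ S′ 𝒫′ N′ →
  S ∼[ T ] S′ → 𝒫 ∼ᶠ[ T ] 𝒫′ → ∀ {s} → s ∈ N → to T s ∈ N′
Nσ-to (empty _ _ N-empty) _ c f s∈N = ⊥-elim (N-empty _ s∈N)
Nσ-to (reduce _ S≢∅ _ _ _) (empty _ S′-empty _) c f = ⊥-elim (S≢∅ (∼-empty (∼-inverse c) S′-empty))
Nσ-to (reduce _ _ _ _ x) (reduce _ _ _ _ y) c f = Nσ-to x y (∼-reduction c f) f
Nσ-to (reduce _ _ r R⊂S _) (step _ _ ¬reducible _ _ _ _) c f =
  ⊥-elim (¬reducible (r , ∼-⊂ (∼-reduction c f) c R⊂S))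
Nσ-to (step _ S≢∅ _ _ _ _ _) (empty _ S′-empty _) c f = ⊥-elim (S≢∅ (∼-empty (∼-inverse c) S′-empty))
Nσ-to (step _ _ ¬reducible _ _ _ _) (reduce _ _ r R′⊂S′ _) c f =
  ⊥-elim (¬reducible (r , ∼-⊂ (∼-inverse (∼-reduction c f)) (∼-inverse c) R′⊂S′))
Nσ-to {σ = σ} {T = T} (step _ _ _ _ M x (N⊆ , _)) (step _ _ _ _ M′ y (_ , ⊆N′)) c f s∈N =
  ⊆N′ (to-assemble M M′ N₀∼N₀′
    (λ o o′ → Nσ-to (proj₂ (x o)) (proj₂ (y o′)) (∼-splitBy c (∼-image T)) (∼ᶠ-inducing f N₀∼N₀′ (∼-image T)))
    (N⊆ s∈N))
  where N₀∼N₀′ = ∼-operation (σ .op 0) c f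

Nσ-∼ : ∀ {σ} {T : Transport G G′} → Nσ G σ S 𝒫 N → Nσ G′ σ S′ 𝒫′ N′ →
  S ∼[ T ] S′ → 𝒫 ∼ᶠ[ T ] 𝒫′ → N ∼[ T ] N′
Nσ-∼ x y c f = corr (Nσ-to x y c f) (Nσ-to y x (∼-inverse c) (∼ᶠ-inverse f))

Nσ-unique : ∀ {σ} → Nσ G σ S 𝒫 N → Nσ G σ S 𝒫 Q → N ≐ Q
Nσ-unique x y = to∈ N∼Q , from∈ N∼Q where N∼Q = Nσ-∼ x y ∼-refl ∼ᶠ-refl

Nσ-resp : ∀ {σ} → Nσ G σ S 𝒫 N → N ≐ Q → Nσ G σ S 𝒫 Q
Nσ-resp (empty feas S-empty N-empty) (_ , Q⊆N) = empty feas S-empty λ s → N-empty s ∘ Q⊆N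
Nσ-resp (reduce feas S≢∅ r R⊂S x) N≐Q = reduce feas S≢∅ r R⊂S (Nσ-resp x N≐Q)
Nσ-resp (step feas S≢∅ ¬reducible nested M x (N⊆ , ⊆N)) (N⊆Q , Q⊆N) =
  step feas S≢∅ ¬reducible nested M x (N⊆ ∘ Q⊆N , N⊆Q ∘ ⊆N)

NΣ-to : {T : Transport G G′} (m : ℕ) (Σ : Vector Strategy (suc m)) → NΣ G m Σ 𝒫 N → NΣ G′ m Σ 𝒫′ N′ →
  𝒫 ∼ᶠ[ T ] 𝒫′ → ∀ {s} → s ∈ N → to T s ∈ N′
NΣ-to {T = T} zero Σ x y f = Nσ-to x y (corr (to-S T) (to-S (inverse T))) f
  where
  to-S : (T : Transport G G′) → ∀ {s} → s ∈ IsSeparation G × s ∈ Proper × order s < 1 →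
         to T s ∈ IsSeparation G′ × to T s ∈ Proper × order (to T s) < 1
  to-S T {s} (sep , proper , s<1) =
    to-separation T sep , to-proper T proper , subst (_< 1) (sym (order-to T s)) s<1
NΣ-to {T = T} (suc m) Σ (N₀ , x , _ , M , y , N⊆ , _) (N₀′ , x′ , _ , M′ , y′ , _ , ⊆N′) f s∈N =
  ⊆N′ (to-assemble M M′ N₀∼N₀′
    (λ o o′ → Nσ-to (y o) (y′ o′)
      (∼-splitBy (corr (to-S T N₀∼N₀′) (to-S (inverse T) (∼-inverse N₀∼N₀′))) (∼-image T))
      (∼ᶠ-inducing f N₀∼N₀′ (∼-image T)))
    (N⊆ s∈N))
  where
  N₀∼N₀′ = corr (NΣ-to m _ x x′ (∼ᶠ-restrict (suc m) f))
                (NΣ-to m _ x′ x (∼ᶠ-inverse (∼ᶠ-restrict (suc m) f)))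

  to-S : (T : Transport G G′) → N ∼[ T ] N′ →
    ∀ {s} → s ∈ IsSeparation G × s ∈ Proper × order s ≡ suc m × s ∈ NestedWith N →
    to T s ∈ IsSeparation G′ × to T s ∈ Proper × order (to T s) ≡ suc m × to T s ∈ NestedWith N′
  to-S T c {s} (sep , proper , s≡ , s∥N) =
    to-separation T sep , to-proper T proper , trans (order-to T s) s≡ , to-nestedWith c s∥N

NΣ-∼ : {T : Transport G G′} (m : ℕ) (Σ : Vector Strategy (suc m)) → NΣ G m Σ 𝒫 N → NΣ G′ m Σ 𝒫′ N′ →
  𝒫 ∼ᶠ[ T ] 𝒫′ → N ∼[ T ] N′
NΣ-∼ m Σ x y f = corr (NΣ-to m Σ x y f) (NΣ-to m Σ y x (∼ᶠ-inverse f))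

private variable
  X : SepSet n
  σ : Strategy

-- Separations splitting an orientation

≐-sym : P ≐ Q → Q ≐ P
≐-sym (p , q) = q , p

orientation? : (G : Graph n) (N O : SepSet n) → Decidable N → O ∈ 𝒪 G N → Decidable O
orientation? G N O N? (O⊆N , (antisymmetric , orient) , _) s with N? s
... | no s∉N  = no (s∉N ∘ O⊆N)
... | yes s∈N with orient s∈N
...   | inj₁ s∈O           = yes s∈O
...   | inj₂ (inv-s∈O , _) = no λ s∈O → antisymmetric s∈O inv-s∈O

-- The orientation contains `s` or `inv s` and cannot consistently take up the other. So `S_O` loses
-- every element of `N`, which is how `|S|` decreases.
orientation-splits∉ : (G : Graph n) (N O : SepSet n) → N ⊆ IsSeparation G → O ∈ 𝒪 G N →
  ∀ {s} → s ∈ N → ¬ Splits G s O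
orientation-splits∉ G N O sep (_ , (_ , orient) , _) {s} s∈N (consistent , consistent′) with orient s∈N
... | inj₁ s∈O           = consistent′ (inj₁ s∈O) (sep s∈N) ≼-refl (inj₂ refl)
... | inj₂ (inv-s∈O , _) = consistent (inj₂ refl) (sep s∈N) ≼-refl (inj₁ inv-s∈O)

below : SepSet n → Pair n → SepSet n
below N s r = r ∈ N × (r ≼ s ⊎ r ≼ inv s)

below? : Decidable N → ∀ s → Decidable (below N s)
below? N? s r = N? r ×-dec (r ≼? s ⊎-dec r ≼? inv s)

-- An `r` in `O` above `s` is inconsistent with `inv s`, and one above `inv s` is inconsistent with
-- `s`, so by nestedness `r` is below `s` or `inv s`. Conversely, if `r` is below one of these and
-- `inv r` were in `O`, that one could not be added consistently.
splits⇒≐below : (G : Graph n) (N O : SepSet n) → N ⊆ IsSeparation G → O ∈ 𝒪 G N →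
  ∀ {s} → s ∈ IsSeparation G → s ∈ NestedWith N →
  Splits G s O → O ≐ below N s
splits⇒≐below G N O sep (O⊆N , (_ , orient) , _) {s} sep-s s∥N (consistent , consistent′) =
  (λ r∈O → O⊆N r∈O , side r∈O (s∥N (O⊆N r∈O))) ,
  (λ (r∈N , r≼) → oriented r∈N r≼ (orient r∈N))
  where
  side : ∀ {r} → r ∈ O → Nested s r → r ≼ s ⊎ r ≼ inv s
  side r∈O (inj₁ (inj₁ s≼r))  = ⊥-elim (consistent′ (inj₁ r∈O) sep-s s≼r (inj₂ refl))
  side r∈O (inj₁ (inj₂ r≼s))  = inj₁ r≼s
  side r∈O (inj₂ (inj₁ s≼r*)) = inj₂ (inv-anti s≼r*)
  side r∈O (inj₂ (inj₂ r*≼s)) =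
    ⊥-elim (consistent (inj₁ r∈O) (separation-inv G sep-s) (inv-anti r*≼s) (inj₂ refl))

  oriented : ∀ {r} → r ∈ N → r ≼ s ⊎ r ≼ inv s → r ∈ O ⊎ inv r ∈ O ∩ N → r ∈ O
  oriented r∈N _           (inj₁ r∈O)        = r∈O
  oriented r∈N (inj₁ r≼s)  (inj₂ (r*∈O , _)) = ⊥-elim (consistent (inj₂ refl) (sep r∈N) r≼s (inj₁ r*∈O))
  oriented r∈N (inj₂ r≼s*) (inj₂ (r*∈O , _)) = ⊥-elim (consistent′ (inj₂ refl) (sep r∈N) r≼s* (inj₁ r*∈O))

inducing-finitary : Finitary 𝒫 → Decidable N → Decidable O → Finitary (inducing 𝒫 N O)
inducing-finitary fin N? O? .member? (i , _) = member? fin i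
inducing-finitary {𝒫 = 𝒫} {N = N} {O = O} fin N? O? .find Q Q? =
  map′ (λ (i , p , q) → (i , p) , q) (λ ((i , p) , q) → i , p , q)
    (find fin (λ P → (P ∩ N ≐ O) × Q P) both?)
  where
  both? : ∀ i → Dec ((𝒫 at i ∩ N ≐ O) × Q (𝒫 at i))
  both? i with ≐-dec (member? fin i ∩? N?) O?
  ... | no ¬p = no (¬p ∘ proj₁)
  ... | yes p = map′ (p ,_) proj₂ (Q? (i , p))

-- Properties of the values of the recursion

Nσ-⊆ : Nσ G σ S 𝒫 N → N ⊆ S
Nσ-⊆ (empty _ _ N-empty) s∈N = ⊥-elim (N-empty _ s∈N)
Nσ-⊆ (reduce _ _ _ _ x) s∈N = proj₁ (Nσ-⊆ x s∈N)
Nσ-⊆ {σ = σ} (step feas _ _ _ M x (N⊆ , _)) s∈N with N⊆ s∈N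
... | inj₁ s∈N₀ = operation-⊆ feas (σ .op 0) s∈N₀
... | inj₂ (O , o , s∈MO) = proj₁ (Nσ-⊆ (proj₂ (x o)) s∈MO)

assemble-inv : (G : Graph n) (N : SepSet n) (M : SepSet n → SepSet n) → (∀ {s} → s ∈ N → inv s ∈ N) →
  (∀ {O} → O ∈ 𝒪 G N → ∀ {s} → s ∈ M O → inv s ∈ M O) →
  ∀ {s} → s ∈ assemble G N M → inv s ∈ assemble G N M
assemble-inv G N M N-inv M-inv (inj₁ s∈N)            = inj₁ (N-inv s∈N)
assemble-inv G N M N-inv M-inv (inj₂ (O , o , s∈MO)) = inj₂ (O , o , M-inv o s∈MO)

Nσ-inv : Nσ G σ S 𝒫 N → ∀ {s} → s ∈ N → inv s ∈ N
Nσ-inv (empty _ _ N-empty) s∈N = ⊥-elim (N-empty _ s∈N)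
Nσ-inv (reduce _ _ _ _ x) = Nσ-inv x
Nσ-inv {G = G} {σ = σ} {S = S} {𝒫 = 𝒫} (step feas _ _ nested M x (N⊆ , ⊆N)) =
  ⊆N ∘ assemble-inv G (⟦ σ .op 0 ⟧ S 𝒫) M (IsSystem.inv-closed (IsNestedSystem.isSystem nested))
         (λ o → Nσ-inv (proj₂ (x o))) ∘ N⊆

-- Relies on every operation being reducing: the others may return elements of `S` that distinguish
-- no two profiles. For `k`-strategies this makes the values essential.
Nσ-distinguishesSomeTwo : (∀ i → IsReducing (σ .op i)) → Nσ G σ S 𝒫 N → N ⊆ DistinguishesSomeTwo 𝒫
Nσ-distinguishesSomeTwo red (empty _ _ N-empty) s∈N = ⊥-elim (N-empty _ s∈N)
Nσ-distinguishesSomeTwo red (reduce _ _ _ _ x) = Nσ-distinguishesSomeTwo red x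
Nσ-distinguishesSomeTwo red (step feas _ _ _ M x (N⊆ , _)) s∈N with N⊆ s∈N
... | inj₁ s∈N₀ = proj₂ (operation-reduction feas (red 0) s∈N₀)
... | inj₂ (O , o , s∈MO) with Nσ-distinguishesSomeTwo (red ∘ suc) (proj₂ (x o)) s∈MO
...   | (i , _) , (j , _) , d = i , j , d

-- The union over orientations arises twice: during a strategy, with `N` inside `S`, and between
-- levels, with `N` of smaller order than `S`. Common to both is that `S` is nested with `N`.
module Assembly {n} {G : Graph n} {N S : SepSet n} {𝒫 : Family n} {σ : Strategy}
  (N-system : IsNestedSystem G N) (N? : Decidable N)
  (sep : S ⊆ IsSeparation G) (S∥N : S ⊆ NestedWith N) where

  open IsNestedSystem N-system
  open IsSystem isSystem

  private
    Value : SepSet n → SepSet n → Set₁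
    Value O X = Nσ G σ (splitBy G S O) (inducing 𝒫 N O) X

  value-≐ : ∀ {O O′ X X′} → O ≐ O′ → Value O X → Value O′ X′ → X ≐ X′
  value-≐ O≐O′ x x′ = to∈ X∼X′ , from∈ X∼X′
    where
    X∼X′ = Nσ-∼ {T = identity} x x′ (∼-splitBy ∼-refl (≐⇒∼ O≐O′)) (∼ᶠ-inducing ∼ᶠ-refl ∼-refl (≐⇒∼ O≐O′))

  ∈value⇒≐below : ∀ {O X s} → O ∈ 𝒪 G N → Value O X → s ∈ X → O ≐ below N s
  ∈value⇒≐below {O} o x s∈X with Nσ-⊆ x s∈X
  ... | s∈S , splits = splits⇒≐below G N O separations o (sep s∈S) (λ t∈N → S∥N s∈S t∈N) splits

  -- Quantifying over orientations raises the universe level. Since s lies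
  -- in M O only if O is below N s, the union can be taken without doing so.
  assemble-exists : (∀ {O} → O ∈ 𝒪 G N → ∃[ X ] Value O X × Decidable X) →
    ∃[ M ] (∀ {O} → O ∈ 𝒪 G N → Value O (M O)) × ∃[ N′ ] N′ ≐ assemble G N M × Decidable N′
  assemble-exists value = M , M-value , U , (U⊆ , ⊆U) , λ s → N? s ⊎-dec M? s
    where
    M : SepSet n → SepSet n
    M O s = Σ[ o ∈ 𝒪 G N O ] s ∈ proj₁ (value o)

    -- `M O` collects the values for all proofs that `O` is an orientation; by uniqueness these
    -- values coincide.
    M-value : ∀ {O} → O ∈ 𝒪 G N → Value O (M O)
    M-value o = Nσ-resp (proj₁ (proj₂ (value o)))
      ( (λ s∈X → o , s∈X)
      , (λ (o′ , s∈X) → proj₁ (Nσ-unique (proj₁ (proj₂ (value o′))) (proj₁ (proj₂ (value o)))) s∈X))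

    U : SepSet n
    U s = s ∈ N ⊎ s ∈ M (below N s)

    U⊆ : U ⊆ assemble G N M
    U⊆ (inj₁ s∈N)       = inj₁ s∈N
    U⊆ (inj₂ (o , s∈X)) = inj₂ (_ , o , o , s∈X)

    ⊆U : assemble G N M ⊆ U
    ⊆U (inj₁ s∈N) = inj₁ s∈N
    ⊆U (inj₂ (O , o , s∈MO)) = inj₂ (proj₁ (value-≐ O≐ (M-value o) (M-value o′)) s∈MO)
      where
      O≐ = ∈value⇒≐below o (M-value o) s∈MO
      o′ = to-𝒪 {N = N} {O = O} {T = identity {G = G}} ∼-refl (≐⇒∼ O≐) o

    M? : ∀ s → Dec (s ∈ M (below N s))
    M? s with 𝒪? G N? (below? N? s)
    ... | no ¬o = no (¬o ∘ proj₁)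
    ... | yes o with proj₂ (proj₂ (value o)) s
    ...   | yes s∈X = yes (o , s∈X)
    ...   | no s∉X  = no λ (o′ , s∈X′) →
              s∉X (proj₁ (Nσ-unique (proj₁ (proj₂ (value o′))) (proj₁ (proj₂ (value o)))) s∈X′)

  -- Elements from different orientations are nested through an `r` on which these disagree: `r` in
  -- `O` is below `s` or `inv s`, and `inv r` in `O′` is below `t` or `inv t`. If the orientations
  -- agree, uniqueness puts both elements into the same nested value.
  assemble-nested : (M : SepSet n → SepSet n) → (∀ {O} → O ∈ 𝒪 G N → Value O (M O)) →
    (∀ {O} → O ∈ 𝒪 G N → NestedSet (M O)) →
    ∀ {s t} → s ∈ assemble G N M → t ∈ assemble G N M → Nested s t
  assemble-nested M M-value M-nested = cases
    where
    ∥N : ∀ {O} (o : O ∈ 𝒪 G N) {s} → s ∈ M O → s ∈ NestedWith N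
    ∥N o s∈MO = S∥N (proj₁ (Nσ-⊆ (M-value o) s∈MO))

    through : ∀ {s t r} → r ≼ s ⊎ r ≼ inv s → inv r ≼ t ⊎ inv r ≼ inv t → Nested s t
    through (inj₁ r≼s)  (inj₁ r*≼t)  = inj₂ (inj₂ (≼-trans (inv-anti r*≼t) r≼s))
    through (inj₁ r≼s)  (inj₂ r*≼t*) = inj₁ (inj₂ (≼-trans (inv-anti r*≼t*) r≼s))
    through (inj₂ r≼s*) (inj₁ r*≼t)  = inj₁ (inj₁ (≼-trans (inv-anti r≼s*) r*≼t))
    through (inj₂ r≼s*) (inj₂ r*≼t*) = inj₂ (inj₁ (≼-trans (inv-anti r≼s*) r*≼t*))

    cases : ∀ {s t} → s ∈ assemble G N M → t ∈ assemble G N M → Nested s t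
    cases (inj₁ s∈N) (inj₁ t∈N) = nested s∈N t∈N
    cases (inj₁ s∈N) (inj₂ (O , o , t∈MO)) = nested-sym (∥N o t∈MO s∈N)
    cases (inj₂ (O , o , s∈MO)) (inj₁ t∈N) = ∥N o s∈MO t∈N
    cases (inj₂ (O , o@(O⊆N , (_ , orient) , _) , s∈MO))
          (inj₂ (O′ , o′@(O′⊆N , (_ , orient′) , _) , t∈MO′))
      with anyPair? (orientation? G N O N? o ∖? orientation? G N O′ N? o′)
    ... | no same = M-nested o s∈MO (proj₂ (value-≐ (O⊆O′ , O′⊆O) (M-value o) (M-value o′)) t∈MO′)
      where
      O⊆O′ : O ⊆ O′
      O⊆O′ {r} r∈O = decidable-stable (orientation? G N O′ N? o′ r) λ r∉O′ → same (r , r∈O , r∉O′)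

      -- Of two orientations of the same set, neither properly contains the other: otherwise `O′`
      -- would contain both `r` and `inv r`.
      O′⊆O : O′ ⊆ O
      O′⊆O {r} r∈O′ with orient (O′⊆N r∈O′)
      ... | inj₁ r∈O        = r∈O
      ... | inj₂ (r*∈O , _) = ⊥-elim (proj₁ (proj₁ (proj₂ o′)) r∈O′ (O⊆O′ r*∈O))
    ... | yes (r , r∈O , r∉O′) with orient′ (O⊆N r∈O)
    ...   | inj₁ r∈O′        = contradiction r∈O′ r∉O′
    ...   | inj₂ (r*∈O′ , _) = through
              (proj₂ (proj₁ (∈value⇒≐below o (M-value o) s∈MO) r∈O))
              (proj₂ (proj₁ (∈value⇒≐below o′ (M-value o′) t∈MO′) r*∈O′))

-- Distinguishing profiles

trace : (N : SepSet n) → IsProfile G P → (∀ {s} → s ∈ N → inv s ∈ N) →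
  (∀ {s} → s ∈ N → s ∈ P ⊎ inv s ∈ P) → (P ∩ N) ∈ 𝒪 G N
trace {G = G} N P-profile N-inv orient =
  proj₂ ,
  ( (λ (s∈P , _) (inv-s∈P , _) → profile-antisymmetric P-profile s∈P inv-s∈P)
  , (λ s∈N → Sum.map (_, s∈N) (λ inv-s∈P → (inv-s∈P , N-inv s∈N) , N-inv s∈N) (orient s∈N))) ,
  consistent-⊆ G proj₁ (IsProfile.consistent P-profile)

agree-or-distinguished : IsProfile G P → IsProfile G Q → Decidable P → Decidable Q → Decidable N →
  (∀ {s} → s ∈ N → s ∈ P ⊎ inv s ∈ P) → (∀ {s} → s ∈ N → s ∈ Q ⊎ inv s ∈ Q) →
  (∃[ s ] s ∈ N × Distinguishes s P Q) ⊎ (P ∩ N ≐ Q ∩ N)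
agree-or-distinguished P-profile Q-profile P? Q? N? P-orients Q-orients
  with anyPair? (N? ∩? distinguishes? P? Q?)
... | yes found = inj₁ found
... | no none   = inj₂
      ( (λ (s∈P , s∈N) → Sum.[ id , (λ s*∈Q → ⊥-elim (none
          (_ , s∈N , between⇒distinguishes P-profile Q-profile s∈P s*∈Q))) ] (Q-orients s∈N) , s∈N)
      , (λ (s∈Q , s∈N) → Sum.[ id , (λ s*∈P → ⊥-elim (none
          (_ , s∈N , Sum.swap (between⇒distinguishes Q-profile P-profile s∈Q s*∈P)))) ] (P-orients s∈N) , s∈N))

-- For a reducing first operation `r[ σ ]≡ 0` holds, so the reduction case can fail only if nothing
-- would be lost. What the operation selects is then nested with all of `S`.
irreducible : Decidable S → Finitary 𝒫 → ¬ (r[ σ ]≡ 0 × reduction S 𝒫 ⊂ S) →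
  IsReducing (σ .op 0) → S ⊆ reduction S 𝒫
irreducible S? fin ¬reducible red {s} s∈S = decidable-stable (reduction? S? fin s) λ s∉R →
  ¬reducible ((red , λ ()) , proj₁ , λ S⊆R → s∉R (S⊆R s∈S))

Nσ-nested : Decidable S → Finitary 𝒫 → Nσ G σ S 𝒫 N → NestedSet N
Nσ-nested S? fin (empty _ _ N-empty) s∈N = ⊥-elim (N-empty _ s∈N)
Nσ-nested S? fin (reduce _ _ _ _ x) = Nσ-nested (reduction? S? fin) fin x
Nσ-nested {G = G} {σ = σ} S? fin (step feas _ ¬reducible N₀-system M x (N⊆ , _)) s∈N t∈N =
  assemble-nested M (proj₂ ∘ x)
    (λ {O} o → Nσ-nested (S? ∩? splits? G (orientation? G _ O N₀? o))
             (inducing-finitary fin N₀? (orientation? G _ O N₀? o))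
             (proj₂ (x o)))
    (N⊆ s∈N) (N⊆ t∈N)
  where
  N₀? = operation? (σ .op 0) S? fin
  open Assembly N₀-system N₀? (IsSystem.separations (IsTask.isSystem (IsFeasible.isTask feas)))
    (λ s∈S t∈N₀ → nested-sym
      (operation-nested feas S? fin (σ .op 0) (irreducible {σ = σ} S? fin ¬reducible) t∈N₀ s∈S))

-- Two profiles that `N₀` does not distinguish induce the same orientation, the trace of either, and
-- are both passed on to the recursive call there. When `S` is empty, the task itself excludes two
-- distinct profiles.
Nσ-distinguishes : Decidable S → Finitary 𝒫 → Nσ G σ S 𝒫 N → DistinguishesAll N 𝒫
Nσ-distinguishes S? fin (empty feas S-empty _) i j i≢j
  with IsTask.distinguishes (IsFeasible.isTask feas) i j i≢j
... | s , s∈S , _ = ⊥-elim (S-empty s s∈S)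
Nσ-distinguishes S? fin (reduce _ _ _ _ x) = Nσ-distinguishes (reduction? S? fin) fin x
Nσ-distinguishes {𝒫 = 𝒫} {G = G} {σ = σ} S? fin (step feas _ ¬reducible N₀-system M x (_ , ⊆N)) i j i≢j =
  Sum.[ (λ (s , s∈N₀ , d) → s , ⊆N (inj₁ s∈N₀) , d)
      , (λ Pi≐Pj → let (s , s∈MO , d) = Nσ-distinguishes
                          (S? ∩? splits? G (orientation? G _ _ N₀? (traceᵢ i)))
                          (inducing-finitary fin N₀? (orientation? G _ _ N₀? (traceᵢ i)))
                          (proj₂ (x (traceᵢ i))) (i , id , id) (j , ≐-sym Pi≐Pj) i≢j
                   in s , ⊆N (inj₂ (_ , traceᵢ i , s∈MO)) , d) ]
    (agree-or-distinguished (profiles i) (profiles j) (member? fin i) (member? fin j) N₀? (orient i) (orient j))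
  where
  open IsTask (IsFeasible.isTask feas)
  N₀? = operation? (σ .op 0) S? fin

  orient : ∀ i {s} → s ∈ ⟦ σ .op 0 ⟧ _ 𝒫 → s ∈ 𝒫 at i ⊎ inv s ∈ 𝒫 at i
  orient i s∈N₀ = task-orients (IsFeasible.isTask feas) i (operation-⊆ feas (σ .op 0) s∈N₀)

  traceᵢ : ∀ i → (𝒫 at i ∩ ⟦ σ .op 0 ⟧ _ 𝒫) ∈ 𝒪 G _
  traceᵢ i = trace _ (profiles i) (operation-inv feas (σ .op 0)) (orient i)

-- Success of the recursion

r-suc : ∀ {r} → ¬ IsReducing (σ .op 0) → r[ shift σ ]≡ r → r[ σ ]≡ suc r
r-suc ¬red₀ (red , least) .proj₁                 = red
r-suc ¬red₀ (red , least) .proj₂ {zero}  _   = ¬red₀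
r-suc ¬red₀ (red , least) .proj₂ {suc i} i<r = least (s≤s⁻¹ i<r)

leastReducing : (σ : Strategy) (r : ℕ) → IsReducing (σ .op r) → ∃[ r₀ ] r[ σ ]≡ r₀
leastReducing σ r red with isReducing? (σ .op 0)
... | yes red₀ = 0 , red₀ , λ ()
leastReducing σ zero red | no ¬red₀ = contradiction red ¬red₀
leastReducing σ (suc r) red | no ¬red₀ with leastReducing (shift σ) r red
... | r₀ , isLeast = suc r₀ , r-suc {σ = σ} ¬red₀ isLeast

-- `S` is a predicate, so `|S|` is measured by the length of a list containing it. The list may be
-- too long; it suffices that it gets shorter whenever an element is lost.
shrink : (L : List (Pair n)) → (∀ {s} → s ∈ S → s ∈ˡ L) → X ⊆ S → ∀ {y} → y ∈ S → y ∉ X →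
  ∃[ L′ ] length L′ < length L × (∀ {s} → s ∈ X → s ∈ˡ L′)
shrink {X = X} L S⊆L X⊆S {y} y∈S y∉X =
  filter ≢y? L ,
  filter-notAll ≢y? L (Any.map (λ y≡t t≢y → t≢y (sym y≡t)) (S⊆L y∈S)) ,
  λ s∈X → ∈-filter⁺ ≢y? (S⊆L (X⊆S s∈X)) λ s≡y → y∉X (subst X s≡y s∈X)
  where
  ≢y? : Decidable (λ t → ¬ (t ≡ y))
  ≢y? t = ¬? (t ≟ᵖ y)

step-exists : IsFeasible G S 𝒫 → Decidable S → Finitary 𝒫 → ¬ Empty S →
  (IsReducing (σ .op 0) → S ⊆ reduction S 𝒫) → let N₀ = ⟦ σ .op 0 ⟧ S 𝒫 in
  (∀ {O} → O ∈ 𝒪 G N₀ → Decidable O → Decreases σ S (splitBy G S O) ×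
     ∃[ X ] Nσ G (shift σ) (splitBy G S O) (inducing 𝒫 N₀ O) X × Decidable X) →
  ∃[ N ] Nσ G σ S 𝒫 N × Decidable N
step-exists {G = G} {S = S} {𝒫 = 𝒫} {σ = σ} feas S? fin S≢∅ S⊆R value
  with assemble-exists (λ o → proj₂ (value′ o))
  where
  N₀? = operation? (σ .op 0) S? fin
  open Assembly {𝒫 = 𝒫} {σ = shift σ} (operation-system feas S? fin (σ .op 0) S⊆R) N₀?
    (IsSystem.separations (IsTask.isSystem (IsFeasible.isTask feas)))
    (λ s∈S t∈N₀ → nested-sym (operation-nested feas S? fin (σ .op 0) S⊆R t∈N₀ s∈S))
  value′ = λ {O} o → value {O} o (orientation? G _ O N₀? o)
... | M , M-value , N , N≐ , N? =
  N , step feas S≢∅ (λ ((red₀ , _) , _ , S⊈R) → S⊈R (S⊆R red₀)) (operation-system feas S? fin (σ .op 0) S⊆R)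
        M (λ {O} o → proj₁ (value o (orientation? G _ O (operation? (σ .op 0) S? fin) o)) , M-value o) N≐ , N?

-- Lexicographic recursion on `c` and `r`, with `r` some index of a reducing operation. A
-- non-reducing operation decreases `r`; otherwise an element of `S` is lost, `c` decreases and
-- `infinitelyOften` provides a new `r`. No list has length below 0, so only `suc c` occurs.
Nσ-exists : (c : ℕ) (σ : Strategy) (r : ℕ) → IsReducing (σ .op r) → {S : SepSet n} {𝒫 : Family n} →
  (L : List (Pair n)) → length L < c → (∀ {s} → s ∈ S → s ∈ˡ L) →
  IsFeasible G S 𝒫 → Decidable S → Finitary 𝒫 → ∃[ N ] Nσ G σ S 𝒫 N × Decidable N
Nσ-exists {n = n} {G = G} (suc c) = go
  where
  smaller : (σ : Strategy) {S S′ : SepSet n} {𝒫 : Family n} (L : List (Pair n)) → length L < suc c →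
    (∀ {s} → s ∈ S → s ∈ˡ L) → S′ ⊆ S → ∀ {y} → y ∈ S → y ∉ S′ →
    IsFeasible G S′ 𝒫 → Decidable S′ → Finitary 𝒫 → ∃[ N ] Nσ G σ S′ 𝒫 N × Decidable N
  smaller σ L L<c S⊆L S′⊆S y∈S y∉S′ with shrink L S⊆L S′⊆S y∈S y∉S′ | σ .infinitelyOften 0
  ... | L′ , L′<L , S′⊆L′ | r , _ , red =
        Nσ-exists c σ r red L′ (<-≤-trans L′<L (s≤s⁻¹ L<c)) S′⊆L′

  go : (σ : Strategy) (r : ℕ) → IsReducing (σ .op r) → {S : SepSet n} {𝒫 : Family n} →
    (L : List (Pair n)) → length L < suc c → (∀ {s} → s ∈ S → s ∈ˡ L) →
    IsFeasible G S 𝒫 → Decidable S → Finitary 𝒫 → ∃[ N ] Nσ G σ S 𝒫 N × Decidable N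
  go σ r red {S} {𝒫} L L<c S⊆L feas S? fin with anyPair? S? | isReducing? (σ .op 0) | r
  ... | no S-empty | _ | _ =
        (λ _ → ⊥) , empty feas (λ s s∈S → S-empty (s , s∈S)) (λ _ ()) , λ _ → no λ ()
  ... | yes _ | no ¬red₀ | zero = contradiction red ¬red₀
  ... | yes (x , x∈S) | no ¬red₀ | suc r′ = step-exists feas S? fin (λ S-empty → S-empty x x∈S)
          (λ red₀ → contradiction red₀ ¬red₀)
          λ {O} o O? →
            -- A non-reducing operation may return nothing and leave `S_O` equal to `S`. The
            -- decrease is then in `r_σ`, which is defined by the least index and not by the given
            -- one.
            let (r⁺ , isLeast) = leastReducing (shift σ) r′ red in
            inj₂ (suc r⁺ , r⁺ , r-suc {σ = σ} ¬red₀ isLeast , isLeast , n<1+n r⁺) ,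
            go (shift σ) r′ red L L<c (S⊆L ∘ proj₁) (split-feasible feas _ O)
              (S? ∩? splits? G O?) (inducing-finitary fin (operation? (σ .op 0) S? fin) O?)
  ... | yes (x , x∈S) | yes red₀ | _ with anyPair? (S? ∖? reduction? S? fin)
  ...   | yes (y , y∈S , y∉R) =
          let (N , value , N?) = smaller σ L L<c S⊆L proj₁ y∈S y∉R (reduction-feasible feas) (reduction? S? fin) fin
          in N , reduce feas (λ S-empty → S-empty x x∈S) (red₀ , λ ()) (proj₁ , λ S⊆R → y∉R (S⊆R y∈S)) value , N?
  ...   | no none = step-exists feas S? fin (λ S-empty → S-empty x x∈S) (λ _ → S⊆R)
          λ {O} o O? →
            let s∉S_O = λ (_ , s-splits) →
                  orientation-splits∉ G _ O (separations ∘ operation-⊆ feas (σ .op 0)) o s∈N₀ s-splits in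
            inj₁ (proj₁ , λ S⊆S_O → s∉S_O (S⊆S_O s∈S)) ,
            smaller (shift σ) L L<c S⊆L proj₁ s∈S s∉S_O (split-feasible feas _ O)
              (S? ∩? splits? G O?) (inducing-finitary fin (operation? (σ .op 0) S? fin) O?)
    where
    open IsSystem (IsTask.isSystem (IsFeasible.isTask feas))

    S⊆R : S ⊆ reduction S 𝒫
    S⊆R {s} s∈S = decidable-stable (reduction? S? fin s) λ s∉R → none (s , s∈S , s∉R)

    nonempty = operation-nonempty feas S? fin red₀ (S⊆R x∈S)
    s∈N₀ = proj₂ nonempty
    s∈S = operation-⊆ feas (σ .op 0) s∈N₀

-- Uncrossing

module _ {G : Graph n} {k : ℕ} {P : SepSet n} (P-k : IsKProfile G k P) where
  open IsKProfile P-k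
  open IsProfile isProfile

  kProfile-orients : ∀ {s} → s ∈ IsSeparation G → order s < k → s ∈ P ⊎ inv s ∈ P
  kProfile-orients sep s<k = Sum.map proj₁ proj₂ (exactlyOne sep s<k)

  -- `exactlyOne` is a disjunction and so decides membership for separations of order below `k`;
  -- `separations` and `small` exclude everything else.
  kProfile-member? : Decidable P
  kProfile-member? s with separation? G s | order s <? k
  ... | no ¬sep | _      = no (¬sep ∘ separations)
  ... | _       | no s≮k = no (s≮k ∘ small)
  ... | yes sep | yes s<k with exactlyOne sep s<k
  ...   | inj₁ (s∈P , _) = yes s∈P
  ...   | inj₂ (s∉P , _) = no s∉P

  ∨-∈ : ∀ {s t} → s ∈ P → t ∈ P → order (s ∨ t) < k → (s ∨ t) ∈ P
  ∨-∈ s∈P t∈P s∨t<k with kProfile-orients (separation-∨ G (separations s∈P) (separations t∈P)) s∨t<k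
  ... | inj₁ s∨t∈P = s∨t∈P
  ... | inj₂ inv∈P = contradiction inv∈P (profile s∈P t∈P)

  below-∈ : ∀ {s t} → s ∈ P → t ∈ IsSeparation G → t ≼ s → order t < k → t ∈ P
  below-∈ s∈P sep t≼s t<k with kProfile-orients sep t<k
  ... | inj₁ t∈P   = t∈P
  ... | inj₂ inv∈P = contradiction inv∈P (consistent s∈P sep t≼s)

  restrict-kProfile : ∀ {ℓ} → ℓ ≤ k → IsKProfile G ℓ (λ s → s ∈ P × order s < ℓ)
  restrict-kProfile {ℓ} ℓ≤k = record
    { isProfile = record
      { separations = separations ∘ proj₁
      ; consistent = consistent-⊆ G proj₁ consistent
      ; profile = λ (s∈P , _) (t∈P , _) (inv∈P , _) → profile s∈P t∈P inv∈P }
    ; small = proj₂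
    ; exactlyOne = λ {s} sep s<ℓ → Sum.map
        (λ (s∈P , inv∉P) → (s∈P , s<ℓ) , inv∉P ∘ proj₁)
        (λ (s∉P , inv∈P) → s∉P ∘ proj₁ , inv∈P , subst (_< ℓ) (sym (order-inv s)) s<ℓ)
        (exactlyOne sep (<-≤-trans s<ℓ ℓ≤k)) }

module _ {G : Graph n} {k : ℕ} {P Q : SepSet n} (P-k : IsKProfile G k P) (Q-k : IsKProfile G k Q) where

  distinct⇒between : ¬ (P ≐ Q) → ∃[ s ] s ∈ P × inv s ∈ Q
  distinct⇒between P≢Q with anyPair? (kProfile-member? P-k ∖? kProfile-member? Q-k)
  ... | yes (s , s∈P , s∉Q)
      with kProfile-orients Q-k (IsProfile.separations (IsKProfile.isProfile P-k) s∈P) (IsKProfile.small P-k s∈P)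
  ...   | inj₁ s∈Q     = contradiction s∈Q s∉Q
  ...   | inj₂ inv-s∈Q = s , s∈P , inv-s∈Q
  distinct⇒between P≢Q | no none = ⊥-elim (P≢Q (P⊆Q , Q⊆P))
    where
    P⊆Q : P ⊆ Q
    P⊆Q {s} s∈P = decidable-stable (kProfile-member? Q-k s) λ s∉Q → none (s , s∈P , s∉Q)

    Q⊆P : Q ⊆ P
    Q⊆P s∈Q
      with kProfile-orients P-k (IsProfile.separations (IsKProfile.isProfile Q-k) s∈Q) (IsKProfile.small Q-k s∈Q)
    ... | inj₁ s∈P     = s∈P
    ... | inj₂ inv-s∈P = contradiction (P⊆Q inv-s∈P) (profile-antisymmetric (IsKProfile.isProfile Q-k) s∈Q)

  -- This is `κ(P, Q) ≥ ℓ`. One direction suffices, since `inv u` has the order of `u`.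
  AtLeast : ℕ → Set
  AtLeast ℓ = ∀ {u} → u ∈ P → inv u ∈ Q → ℓ ≤ order u

  -- By modularity of the order, if s ∨ r had larger order than s, then the
  -- opposite corner would distinguish P from Q with smaller order than r.
  order-∨-≤ : ∀ {s r} → s ∈ IsSeparation G → r ∈ P → inv r ∈ Q → inv s ∈ Q → AtLeast (order r) →
    order (s ∨ r) ≤ order s
  order-∨-≤ {s} {r} sep-s r∈P inv-r∈Q inv-s∈Q least with order (s ∨ r) ≤? order s
  ... | yes s∨r≤s = s∨r≤s
  ... | no s∨r≰s  = contradiction (least c*∈P c∈Q) (<⇒≱ c*<r)
    where
    open IsProfile (IsKProfile.isProfile P-k) using () renaming (separations to separation-P)

    c = inv s ∨ inv r

    c<r : order c < order r
    c<r = ≰⇒> λ r≤c → <-irrefl (sym (order-∨ G sep-s (separation-P r∈P))) (+-mono-<-≤ (≰⇒> s∨r≰s) r≤c)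

    c*<r : order (inv c) < order r
    c*<r = subst (_< order r) (sym (order-inv c)) c<r

    c∈Q : c ∈ Q
    c∈Q = ∨-∈ Q-k inv-s∈Q inv-r∈Q (<-trans c<r (IsKProfile.small P-k r∈P))

    c*∈P : inv c ∈ P
    c*∈P = below-∈ P-k r∈P
      (separation-inv G (separation-∨ G (separation-inv G sep-s) (separation-inv G (separation-P r∈P))))
      (inv-anti (∨-upperʳ (inv s) (inv r))) (<-trans c*<r (IsKProfile.small P-k r∈P))

  ∨-between : ∀ {s t} → s ∈ P → t ∈ P → inv s ∈ Q → order (s ∨ t) < k →
    (s ∨ t) ∈ P × inv (s ∨ t) ∈ Q
  ∨-between {s} {t} s∈P t∈P inv-s∈Q s∨t<k =
    ∨-∈ P-k s∈P t∈P s∨t<k ,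
    below-∈ Q-k inv-s∈Q (separation-inv G (separation-∨ G (separations s∈P) (separations t∈P)))
      (inv-anti (∨-upperˡ s t)) (subst (_< k) (sym (order-inv (s ∨ t))) s∨t<k)
    where open IsProfile (IsKProfile.isProfile P-k)

  between⇒efficient : ∀ {s} → s ∈ IsSeparation G → Distinguishes s P Q → AtLeast (order s) →
    EfficientlyDistinguishes G s P Q
  between⇒efficient {s} sep d least = sep , d , (s , sep , d , refl) , λ {u} _ d′ →
    Sum.[ (λ (u∈P , u*∈Q) → least u∈P u*∈Q)
        , (λ (u*∈P , u∈Q) → subst (order s ≤_) (order-inv u) (least u*∈P u∈Q)) ]
      (distinguishes⇒between P Q u d′)

AtLeast-inv : {G : Graph n} {k ℓ : ℕ} {P Q : SepSet n} (P-k : IsKProfile G k P) (Q-k : IsKProfile G k Q) →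
  AtLeast P-k Q-k ℓ → AtLeast Q-k P-k ℓ
AtLeast-inv {ℓ = ℓ} P-k Q-k least {u} u∈Q u*∈P = subst (ℓ ≤_) (order-inv u) (least u*∈P u∈Q)

-- The last component allows repetition: elements of `N` that are nested with `s` remain nested with
-- `e`, since within `N` they are nested with `r`.
Uncrossed : (s r : Pair n) (P Q : SepSet n) → Set
Uncrossed s r P Q = ∃[ e ] e ∈ P × inv e ∈ Q × order e ≤ order s × Nested e r ×
  (∀ {t} → Nested t s → Nested t r → Nested t e)

module _ {G : Graph n} {k : ℕ} {P P′ Q Q′ : SepSet n}
  (P-k : IsKProfile G k P) (P′-k : IsKProfile G k P′) (Q-k : IsKProfile G k Q) (Q′-k : IsKProfile G k Q′) where

  -- The orientation of `s` in `Q′` selects the corner. With `inv s` in `Q′`, the join `s ∨ r` has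
  -- order at most that of `s`, as the opposite corner would otherwise distinguish `Q` from `Q′` too
  -- cheaply; with `s` in `Q′`, the same holds for `inv s ∨ r`. Since `P` and `P′` share `r`, either
  -- join still distinguishes them, in the second case with their roles exchanged.
  uncross : ∀ {s r} → Cross s r → s ∈ P → inv s ∈ P′ → r ∈ P → r ∈ P′ →
    r ∈ Q → inv r ∈ Q′ → AtLeast Q-k Q′-k (order r) → Uncrossed s r P P′
  uncross {s} {r} s×r s∈P s*∈P′ r∈P r∈P′ r∈Q r*∈Q′ least
    with kProfile-orients Q′-k (IsProfile.separations (IsKProfile.isProfile P-k) s∈P) (IsKProfile.small P-k s∈P)
  ... | inj₂ s*∈Q′ =
        s ∨ r , proj₁ between , proj₂ between , s∨r≤s , nested-∨ʳ s r , λ {t} → nested-∨ s r t s×r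
    where
    s∨r≤s = order-∨-≤ Q-k Q′-k (IsProfile.separations (IsKProfile.isProfile P-k) s∈P) r∈Q r*∈Q′ s*∈Q′ least
    between = ∨-between P-k P′-k s∈P r∈P s*∈P′ (≤-<-trans s∨r≤s (IsKProfile.small P-k s∈P))
  ... | inj₁ s∈Q′ =
        inv e , proj₂ between , proj₁ between ,
        subst₂ _≤_ (sym (order-inv e)) (order-inv s) e≤s ,
        nested-invˡ (nested-∨ʳ (inv s) r) ,
        λ {t} t∥s t∥r → nested-invʳ (nested-∨ (inv s) r t (s×r ∘ nested-invˡ) (nested-invʳ t∥s) t∥r)
    where
    e = inv s ∨ r
    e≤s = order-∨-≤ Q-k Q′-k (IsProfile.separations (IsKProfile.isProfile P′-k) s*∈P′) r∈Q r*∈Q′ s∈Q′ least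
    between = ∨-between P′-k P-k s*∈P′ r∈P′ s∈P (≤-<-trans e≤s (IsKProfile.small P′-k s*∈P′))

-- Truncating the profiles at `ℓ` discards only distinguishing separations of order at least `ℓ`,
-- which exceeds the order of `s`. So efficiency is no artefact of the truncation.
restricted-efficient : {G : Graph n} {k ℓ : ℕ} {P Q : SepSet n} {s : Pair n}
  (P-k : IsKProfile G k P) (Q-k : IsKProfile G k Q) →
  ℓ ≤ k → EfficientlyDistinguishes G s (λ t → t ∈ P × order t < ℓ) (λ t → t ∈ Q × order t < ℓ) →
  order s < ℓ × AtLeast P-k Q-k (order s) × ((s ∈ P × inv s ∈ Q) ⊎ (inv s ∈ P × s ∈ Q))
restricted-efficient {ℓ = ℓ} {P = P} {Q = Q} {s = s} P-k Q-k ℓ≤k (sep , d , _ , least) =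
  s<ℓ , least′ , Sum.map (λ ((p , _) , (q , _)) → p , q) (λ ((p , _) , (q , _)) → p , q) between
  where
  between = distinguishes⇒between (λ t → t ∈ P × order t < ℓ) (λ t → t ∈ Q × order t < ℓ) s d

  s<ℓ : order s < ℓ
  s<ℓ = Sum.[ proj₂ ∘ proj₁ , proj₂ ∘ proj₂ ] between

  least′ : AtLeast P-k Q-k (order s)
  least′ {u} u∈P u*∈Q with order u <? ℓ
  ... | no u≮ℓ  = ≤-trans (<⇒≤ s<ℓ) (≮⇒≥ u≮ℓ)
  ... | yes u<ℓ = least (IsProfile.separations (IsKProfile.isProfile P-k) u∈P)
        (between⇒distinguishes (IsKProfile.isProfile (restrict-kProfile P-k ℓ≤k))
          (IsKProfile.isProfile (restrict-kProfile Q-k ℓ≤k))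
          (u∈P , u<ℓ) (u*∈Q , subst (_< ℓ) (sym (order-inv u)) u<ℓ))

-- Tasks of bounded order

-- The witness for feasibility is the join itself. No separation of order below `ℓ` distinguishes
-- the profiles, so `t`, of order at most `ℓ`, does so as cheaply as possible, and `order-∨-≤`
-- bounds the join by the order of `s`.
level-feasible : {G : Graph n} {k ℓ : ℕ} {S : SepSet n} {𝒫 : Family n} (𝒫-k : ∀ i → IsKProfile G k (𝒫 at i)) →
  ℓ < k → S ⊆ IsSeparation G → S ⊆ Proper → (∀ {s} → s ∈ S → inv s ∈ S) →
  (∀ {s} → s ∈ S → order s ≤ ℓ) → (∀ i j → AtLeast (𝒫-k i) (𝒫-k j) ℓ) → DistinguishesAll S 𝒫 →
  (∀ {s t} → s ∈ S → t ∈ S → Cross s t → ∀ i j → (s ∨ t) ∈ 𝒫 at i → inv (s ∨ t) ∈ 𝒫 at j →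
    order (s ∨ t) ≤ ℓ → (s ∨ t) ∈ S) →
  IsFeasible G S 𝒫
level-feasible {G = G} {ℓ = ℓ} {𝒫 = 𝒫} 𝒫-k ℓ<k sep S-proper S-inv S≤ℓ least dist ∨-closed = record
  { isTask = record
    { isSystem = record { separations = sep ; inv-closed = S-inv }
    ; proper = S-proper
    ; profiles = λ i → IsKProfile.isProfile (𝒫-k i)
    ; orients = λ i → profile-antisymmetric (IsKProfile.isProfile (𝒫-k i)) , λ s∈S →
        Sum.map₂ (_, S-inv s∈S) (kProfile-orients (𝒫-k i) (sep s∈S) (≤-<-trans (S≤ℓ s∈S) ℓ<k))
    ; distinguishes = dist }
  ; feasible = λ {s} {t} s∈S t∈S s×t i j s∈P t∈P s*∈P′ t*∈P′ →
      let s∨t≤ℓ = ≤-trans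
            (order-∨-≤ (𝒫-k i) (𝒫-k j) (sep s∈S) t∈P t*∈P′ s*∈P′
              (λ u∈P u*∈P′ → ≤-trans (S≤ℓ t∈S) (least i j u∈P u*∈P′)))
            (S≤ℓ s∈S)
          (s∨t∈P , s∨t*∈P′) = ∨-between (𝒫-k i) (𝒫-k j) s∈P t∈P s*∈P′ (≤-<-trans s∨t≤ℓ ℓ<k)
      in s ∨ t , (s∨t∈P , ∨-closed s∈S t∈S s×t i j s∨t∈P s∨t*∈P′ s∨t≤ℓ) , ≼-refl }

kProfiles-finitary : {G : Graph n} {k p : ℕ} {P : Fin p → SepSet n} → (∀ i → IsKProfile G k (P i)) →
  Finitary (family (Fin p) P)
kProfiles-finitary P-k .member? i = kProfile-member? (P-k i)
kProfiles-finitary P-k .find Q Q? = any? Q?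

-- Success of the recursion for k-strategies

-- Besides the claims of the theorem this carries decidability, because the next level searches the
-- result for elements that a given separation crosses.
record Solution (G : Graph n) (m : ℕ) (Σ : Vector Strategy (suc m))
                {p} (P : Fin p → SepSet n) : Set₁ where
  field
    result     : SepSet n
    derivation : NΣ G m Σ (family (Fin p) P) result
    system     : IsNestedSystem G result
    essential  : ∀ {s} → s ∈ result → s ∈ Essential G (family (Fin p) P) × order s < suc m
    efficient  : EfficientlyDistinguishesAll G result (family (Fin p) P)
    result?    : Decidable result

module FirstLevel {n : ℕ} {G : Graph n} {p : ℕ}
  (P : Fin p → SepSet n) (P-k : ∀ i → IsKProfile G 1 (P i)) where

  profiles : Family n
  profiles = family (Fin p) P

  candidates : SepSet n
  candidates s = s ∈ IsSeparation G × s ∈ Proper × order s < 1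

  candidate? : Decidable candidates
  candidate? s = separation? G s ×-dec proper? s ×-dec order s <? 1

  between⇒∈S : ∀ i j {s} → s ∈ P i → inv s ∈ P j → s ∈ candidates
  between⇒∈S i j s∈P s*∈Q = IsProfile.separations (IsKProfile.isProfile (P-k i)) s∈P ,
    between⇒proper (IsKProfile.isProfile (P-k i)) (IsKProfile.isProfile (P-k j)) s∈P s*∈Q ,
    IsKProfile.small (P-k i) s∈P

  -- Here `ℓ = 0`: lower bounds on orders are trivial, and any separation distinguishing two of the
  -- profiles is a candidate.
  feasible : IsFeasible G candidates profiles
  feasible = level-feasible P-k ≤-refl proj₁ (proj₁ ∘ proj₂)
    (λ {s} (sep , (A⊈B , B⊈A) , s<1) →
      separation-inv G sep , (B⊈A , A⊈B) , subst (_< 1) (sym (order-inv s)) s<1)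
    (λ (_ , _ , s<1) → s≤s⁻¹ s<1)
    (λ _ _ _ _ → z≤n)
    (λ i j i≢j → let (s , s∈P , s*∈Q) = distinct⇒between (P-k i) (P-k j) i≢j in
      s , between⇒∈S i j s∈P s*∈Q ,
      between⇒distinguishes (IsKProfile.isProfile (P-k i)) (IsKProfile.isProfile (P-k j)) s∈P s*∈Q)
    (λ _ _ _ i j s∈P s*∈Q _ → between⇒∈S i j s∈P s*∈Q)

  first : (Σ : Vector Strategy 1) → (∀ ℓ i → IsReducing (Σ ℓ .op i)) → Solution G 0 Σ P
  first Σ red = verify
    (Nσ-exists (suc (length (pairs n))) (last Σ) 0 (red _ 0) (pairs n) ≤-refl (λ {s} _ → ∈-pairs s)
      feasible candidate? (kProfiles-finitary P-k))
    where
    verify : ∃[ N ] Nσ G (last Σ) candidates profiles N × Decidable N → Solution G 0 Σ P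
    verify (N , value , N?) = record
      { result = N
      ; derivation = value
      ; system = record
        { isSystem = record { separations = proj₁ ∘ N⊆S ; inv-closed = Nσ-inv value }
        ; nested = Nσ-nested candidate? (kProfiles-finitary P-k) value }
      ; essential = λ s∈N →
          (let (i , j , d) = Nσ-distinguishesSomeTwo (red _) value s∈N in i , j , efficiently i j s∈N d) ,
          proj₂ (proj₂ (N⊆S s∈N))
      ; efficient = λ i j i≢j →
          let (s , s∈N , d) = Nσ-distinguishes candidate? (kProfiles-finitary P-k) value i j i≢j in
          s , s∈N , efficiently i j s∈N d
      ; result? = N? }
      where
      N⊆S : N ⊆ candidates
      N⊆S = Nσ-⊆ value

      efficiently : ∀ i j {s} → s ∈ N → Distinguishes s (P i) (P j) → EfficientlyDistinguishes G s (P i) (P j)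
      efficiently i j s∈N d = between⇒efficient (P-k i) (P-k j) (proj₁ (N⊆S s∈N)) d
        (λ _ _ → ≤-trans (s≤s⁻¹ (proj₂ (proj₂ (N⊆S s∈N)))) z≤n)

module NextLevel {n : ℕ} {G : Graph n} {m p : ℕ}
  (P : Fin p → SepSet n) (P-k : ∀ i → IsKProfile G (suc (suc m)) (P i))
  {N : SepSet n} (system : IsNestedSystem G N) (N? : Decidable N)
  (essential : ∀ {s} → s ∈ N → s ∈ Essential G (restrict (suc m) (family (Fin p) P)) × order s < suc m)
  (efficient : EfficientlyDistinguishesAll G N (restrict (suc m) (family (Fin p) P))) where

  open IsNestedSystem system
  open IsSystem isSystem

  profiles : Family n
  profiles = family (Fin p) P

  profile : ∀ i → IsProfile G (P i)
  profile i = IsKProfile.isProfile (P-k i)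

  N-orients : ∀ i {s} → s ∈ N → s ∈ P i ⊎ inv s ∈ P i
  N-orients i s∈N = kProfile-orients (P-k i) (separations s∈N) (m<n⇒m<1+n (proj₂ (essential s∈N)))

  restricted : ∀ i j {s} →
    EfficientlyDistinguishes G s (restrict (suc m) profiles at i) (restrict (suc m) profiles at j) →
    order s < suc m × AtLeast (P-k i) (P-k j) (order s) × ((s ∈ P i × inv s ∈ P j) ⊎ (inv s ∈ P i × s ∈ P j))
  restricted i j = restricted-efficient (P-k i) (P-k j) (n≤1+n _)

  restricted-essential : ∀ {s} → s ∈ N →
    ∃[ i ] ∃[ j ] s ∈ P i × inv s ∈ P j × AtLeast (P-k i) (P-k j) (order s)
  restricted-essential s∈N with essential s∈N
  ... | (i , j , eff) , _ with restricted i j eff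
  ...   | _ , least , inj₁ (s∈P , s*∈Q) = i , j , s∈P , s*∈Q , least
  ...   | _ , least , inj₂ (s*∈P , s∈Q) = j , i , s∈Q , s*∈P , AtLeast-inv (P-k i) (P-k j) least

  -- A `u` of order below `suc m` would make the truncations at `suc m` distinct, and some element
  -- of `N` would then distinguish two profiles that agree on `N`.
  agree⇒atLeast : ∀ i j → P i ∩ N ≐ P j ∩ N → AtLeast (P-k i) (P-k j) (suc m)
  agree⇒atLeast i j (Pi⊆Pj , Pj⊆Pi) {u} u∈Pi u*∈Pj with order u <? suc m
  ... | no u≮m  = ≮⇒≥ u≮m
  ... | yes u<m
      with efficient i j (λ (Pi⊆ , _) → profile-antisymmetric (profile j) (proj₁ (Pi⊆ (u∈Pi , u<m))) u*∈Pj)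
  ...   | r , r∈N , eff with proj₂ (proj₂ (restricted i j eff))
  ...     | inj₁ (r∈Pi , r*∈Pj) = ⊥-elim (profile-antisymmetric (profile j) (proj₁ (Pi⊆Pj (r∈Pi , r∈N))) r*∈Pj)
  ...     | inj₂ (r*∈Pi , r∈Pj) = ⊥-elim (profile-antisymmetric (profile i) (proj₁ (Pj⊆Pi (r∈Pj , r∈N))) r*∈Pi)

  -- Being essential, `r` efficiently distinguishes the truncations of some pair `a`, `b`, which
  -- supplies the other two profiles for `uncross`. Of `r` and `inv r`, the one shared by the
  -- profiles `i` and `j` is used; passing to `inv r` exchanges `a` and `b`.
  uncross-one : ∀ i j → P i ∩ N ≐ P j ∩ N → ∀ {s r} → s ∈ P i → inv s ∈ P j → r ∈ N → Cross s r →
    Uncrossed s r (P i) (P j)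
  uncross-one i j (Pi⊆Pj , _) {s} {r} s∈Pi s*∈Pj r∈N s×r with restricted-essential r∈N | N-orients i r∈N
  ... | a , b , r∈Pa , r*∈Pb , least | inj₁ r∈Pi =
        uncross (P-k i) (P-k j) (P-k a) (P-k b) s×r s∈Pi s*∈Pj r∈Pi (proj₁ (Pi⊆Pj (r∈Pi , r∈N))) r∈Pa r*∈Pb least
  ... | a , b , r∈Pa , r*∈Pb , least | inj₂ r*∈Pi
      with uncross (P-k i) (P-k j) (P-k b) (P-k a) (s×r ∘ nested-invʳ) s∈Pi s*∈Pj
             r*∈Pi (proj₁ (Pi⊆Pj (r*∈Pi , inv-closed r∈N))) r*∈Pb r∈Pa
             (subst (AtLeast (P-k b) (P-k a)) (sym (order-inv r)) (AtLeast-inv (P-k a) (P-k b) least))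
  ...   | e , e∈Pi , e*∈Pj , e≤s , e∥r* , nested-e =
          e , e∈Pi , e*∈Pj , e≤s , nested-invʳ e∥r* , λ t∥s t∥r → nested-e t∥s (nested-invʳ t∥r)

  uncross-all : ∀ i j → P i ∩ N ≐ P j ∩ N → ∀ {s} → s ∈ P i → inv s ∈ P j →
    ∃[ e ] e ∈ P i × inv e ∈ P j × order e ≤ order s × e ∈ NestedWith N
  uncross-all i j agree {s} s∈Pi s*∈Pj with go (pairs n)
    where
    go : (L : List (Pair n)) → ∃[ e ] e ∈ P i × inv e ∈ P j × order e ≤ order s ×
      (∀ {r} → r ∈ˡ L → r ∈ N → Nested e r)
    go [] = s , s∈Pi , s*∈Pj , ≤-refl , λ ()
    go (r ∷ L) with go L
    ... | e , e∈Pi , e*∈Pj , e≤s , e∥L with N? r | nested? e r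
    ...   | no r∉N | _ = e , e∈Pi , e*∈Pj , e≤s , λ where
              (here refl) r∈N → contradiction r∈N r∉N
              (there t∈L) → e∥L t∈L
    ...   | yes _ | yes e∥r = e , e∈Pi , e*∈Pj , e≤s , λ where
              (here refl) _ → e∥r
              (there t∈L) → e∥L t∈L
    ...   | yes r∈N | no e×r with uncross-one i j agree e∈Pi e*∈Pj r∈N e×r
    ...     | e′ , e′∈Pi , e′*∈Pj , e′≤e , e′∥r , nested-e′ = e′ , e′∈Pi , e′*∈Pj , ≤-trans e′≤e e≤s , λ where
                (here refl) _ → e′∥r
                -- `t` and `r` are nested because both are in `N`, so the corner inherits nestedness
                -- with the elements treated earlier.
                (there t∈L) t∈N → nested-sym (nested-e′ (nested-sym (e∥L t∈L t∈N)) (nested t∈N r∈N))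
  ... | e , e∈Pi , e*∈Pj , e≤s , e∥N = e , e∈Pi , e*∈Pj , e≤s , λ {t} → e∥N (∈-pairs t)

  candidates : SepSet n
  candidates s = s ∈ IsSeparation G × s ∈ Proper × order s ≡ suc m × s ∈ NestedWith N

  candidate? : Decidable candidates
  candidate? s = separation? G s ×-dec proper? s ×-dec order s ≟ suc m ×-dec nestedWith? N? s

  S-inv : ∀ {s} → s ∈ candidates → inv s ∈ candidates
  S-inv {s} (sep , (A⊈B , B⊈A) , s≡m , s∥N) =
    separation-inv G sep , (B⊈A , A⊈B) , trans (order-inv s) s≡m , λ t∈N → nested-invˡ (s∥N t∈N)

  module _ (O : SepSet n) where

    agree : ∀ {i j} → P i ∩ N ≐ O → P j ∩ N ≐ O → P i ∩ N ≐ P j ∩ N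
    agree (Pi⊆O , O⊆Pi) (Pj⊆O , O⊆Pj) = (λ s∈ → O⊆Pj (Pi⊆O s∈)) , (λ s∈ → O⊆Pi (Pj⊆O s∈))

    -- Smaller orders are excluded because the two profiles agree on `N`, so a separation of order
    -- at most `suc m` found by uncrossing or as a join has order exactly `suc m`.
    between⇒∈S : ∀ {i j} → P i ∩ N ≐ O → P j ∩ N ≐ O → ∀ {s} → s ∈ P i → inv s ∈ P j →
      order s ≤ suc m → s ∈ NestedWith N → s ∈ splitBy G candidates O
    between⇒∈S {i} {j} Pi≐O Pj≐O s∈Pi s*∈Pj s≤m s∥N =
      ( IsProfile.separations (profile i) s∈Pi
      , between⇒proper (profile i) (profile j) s∈Pi s*∈Pj
      , ≤-antisym s≤m (agree⇒atLeast i j (agree Pi≐O Pj≐O) s∈Pi s*∈Pj)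
      , s∥N) ,
      between⇒splits G (IsProfile.consistent (profile i)) (IsProfile.consistent (profile j))
        (proj₁ ∘ proj₂ Pi≐O) (proj₁ ∘ proj₂ Pj≐O) s∈Pi s*∈Pj

    feasible : IsFeasible G (splitBy G candidates O) (inducing profiles N O)
    feasible = level-feasible (P-k ∘ proj₁) ≤-refl (proj₁ ∘ proj₁) (proj₁ ∘ proj₂ ∘ proj₁)
      (λ (s∈S , s-splits) → S-inv s∈S , splits-inv G s-splits)
      (λ ((_ , _ , s≡m , _) , _) → ≤-reflexive s≡m)
      (λ (i , Pi≐O) (j , Pj≐O) → agree⇒atLeast i j (agree Pi≐O Pj≐O))
      (λ (i , Pi≐O) (j , Pj≐O) i≢j →
        let (s , s∈Pi , s*∈Pj) = distinct⇒between (P-k i) (P-k j) i≢j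
            (e , e∈Pi , e*∈Pj , e≤s , e∥N) = uncross-all i j (agree Pi≐O Pj≐O) s∈Pi s*∈Pj
        in e , between⇒∈S Pi≐O Pj≐O e∈Pi e*∈Pj (≤-trans e≤s (s≤s⁻¹ (IsKProfile.small (P-k i) s∈Pi))) e∥N ,
           between⇒distinguishes (profile i) (profile j) e∈Pi e*∈Pj)
      (λ {s} {t} ((_ , _ , _ , s∥N) , _) ((_ , _ , _ , t∥N) , _) s×t (i , Pi≐O) (j , Pj≐O) ∈Pi ∈Pj s∨t≤m →
        between⇒∈S Pi≐O Pj≐O ∈Pi ∈Pj s∨t≤m
          λ {r} r∈N → nested-sym (nested-∨ s t r s×t (nested-sym (s∥N r∈N)) (nested-sym (t∥N r∈N))))

  split? : ∀ {O} → O ∈ 𝒪 G N → Decidable (splitBy G candidates O)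
  split? {O} o = candidate? ∩? splits? G (orientation? G N O N? o)

  inducing? : ∀ {O} → O ∈ 𝒪 G N → Finitary (inducing profiles N O)
  inducing? {O} o = inducing-finitary (kProfiles-finitary P-k) N? (orientation? G N O N? o)

  module _ {σ : Strategy} (red : ∀ i → IsReducing (σ .op i)) where
    open Assembly {S = candidates} {𝒫 = profiles} {σ = σ} system N? proj₁ (λ (_ , _ , _ , s∥N) → s∥N)

    module _ (M : SepSet n → SepSet n)
      (M-value : ∀ {O} → O ∈ 𝒪 G N → Nσ G σ (splitBy G candidates O) (inducing profiles N O) (M O)) where

      M-efficient : ∀ {O s} (o : O ∈ 𝒪 G N) → s ∈ M O → ∀ {i j} → P i ∩ N ≐ O → P j ∩ N ≐ O →
        Distinguishes s (P i) (P j) → EfficientlyDistinguishes G s (P i) (P j)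
      M-efficient {O} o s∈MO {i} {j} Pi≐O Pj≐O d with Nσ-⊆ (M-value o) s∈MO
      ... | (sep , _ , s≡m , _) , _ = between⇒efficient (P-k i) (P-k j) sep d
            λ u∈P u*∈Q → ≤-trans (≤-reflexive s≡m) (agree⇒atLeast i j (agree O Pi≐O Pj≐O) u∈P u*∈Q)

      N-efficient : ∀ i j {s} →
        EfficientlyDistinguishes G s (restrict (suc m) profiles at i) (restrict (suc m) profiles at j) →
        EfficientlyDistinguishes G s (P i) (P j)
      N-efficient i j eff@(sep , _) with restricted i j eff
      ... | _ , least , between = between⇒efficient (P-k i) (P-k j) sep
            (Sum.[ (λ (s∈P , s*∈Q) → between⇒distinguishes (profile i) (profile j) s∈P s*∈Q)
                 , (λ (s*∈P , s∈Q) → Sum.swap (between⇒distinguishes (profile j) (profile i) s∈Q s*∈P)) ] between)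
            least

      assemble-separations : assemble G N M ⊆ IsSeparation G
      assemble-separations (inj₁ s∈N)            = separations s∈N
      assemble-separations (inj₂ (O , o , s∈MO)) = proj₁ (proj₁ (Nσ-⊆ (M-value o) s∈MO))

      assemble-essential : ∀ {s} → s ∈ assemble G N M → s ∈ Essential G profiles × order s < suc (suc m)
      assemble-essential (inj₁ s∈N) with essential s∈N
      ... | (i , j , eff) , s<m = (i , j , N-efficient i j eff) , m<n⇒m<1+n s<m
      assemble-essential (inj₂ (O , o , s∈MO)) with Nσ-distinguishesSomeTwo red (M-value o) s∈MO
      ... | (i , Pi≐O) , (j , Pj≐O) , d =
            (i , j , M-efficient o s∈MO Pi≐O Pj≐O d) ,
            s≤s (≤-reflexive (proj₁ (proj₂ (proj₂ (proj₁ (Nσ-⊆ (M-value o) s∈MO))))))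

      -- Profiles with distinct truncations at `suc m` are handled by `N`. Equal truncations force
      -- the same trace on `N`, whose elements have order below `suc m`; the call at this trace then
      -- distinguishes the profiles by a separation of order `suc m`, the least possible.
      assemble-efficient : ∀ i j → ¬ (P i ≐ P j) →
        ∃[ s ] s ∈ assemble G N M × EfficientlyDistinguishes G s (P i) (P j)
      assemble-efficient i j i≢j
        with ≐-dec (kProfile-member? (restrict-kProfile (P-k i) (n≤1+n _)))
                   (kProfile-member? (restrict-kProfile (P-k j) (n≤1+n _)))
      ... | no ≢  = let (s , s∈N , eff) = efficient i j ≢ in s , inj₁ s∈N , N-efficient i j eff
      ... | yes (⊆ , ⊇) =
            let (s , s∈MO , d) = Nσ-distinguishes (split? o) (inducing? o) (M-value o) (i , id , id) (j , Pj≐O) i≢j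
            in s , inj₂ (_ , o , s∈MO) , M-efficient o s∈MO (id , id) Pj≐O d
        where
        o : (P i ∩ N) ∈ 𝒪 G N
        o = trace N (profile i) inv-closed (N-orients i)

        Pj≐O : P j ∩ N ≐ P i ∩ N
        Pj≐O = (λ (s∈P , s∈N) → proj₁ (⊇ (s∈P , proj₂ (essential s∈N))) , s∈N) ,
               (λ (s∈P , s∈N) → proj₁ (⊆ (s∈P , proj₂ (essential s∈N))) , s∈N)

    record Next : Set₁ where
      field
        values      : SepSet n → SepSet n
        derivation  : ∀ {O} → O ∈ 𝒪 G N → Nσ G σ (splitBy G candidates O) (inducing profiles N O) (values O)
        result      : SepSet n
        result≐     : result ≐ assemble G N values
        system′     : IsNestedSystem G result
        essential′  : ∀ {s} → s ∈ result → s ∈ Essential G profiles × order s < suc (suc m)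
        efficient′  : EfficientlyDistinguishesAll G result profiles
        result?     : Decidable result

    next : Next
    next = verify (assemble-exists λ {O} o →
      Nσ-exists (suc (length (pairs n))) σ 0 (red 0) (pairs n) ≤-refl (λ {s} _ → ∈-pairs s)
        (feasible O) (split? o) (inducing? o))
      where
      verify : ∃[ M ] (∀ {O} → O ∈ 𝒪 G N → Nσ G σ (splitBy G candidates O) (inducing profiles N O) (M O)) ×
               ∃[ U ] U ≐ assemble G N M × Decidable U → Next
      verify (M , M-value , U , U≐@(U⊆ , ⊆U) , U?) = record
        { values = M ; derivation = M-value ; result = U ; result≐ = U≐
        ; system′ = record
          { isSystem = record
            { separations = λ s∈ → assemble-separations M M-value (U⊆ s∈)
            ; inv-closed = λ s∈ → ⊆U (assemble-inv G N M inv-closed (λ o → Nσ-inv (M-value o)) (U⊆ s∈)) }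
          ; nested = λ s∈ t∈ → assemble-nested M M-value
              (λ o → Nσ-nested (split? o) (inducing? o) (M-value o)) (U⊆ s∈) (U⊆ t∈) }
        ; essential′ = λ s∈ → assemble-essential M M-value (U⊆ s∈)
        ; efficient′ = λ i j i≢j →
            let (s , s∈ , eff) = assemble-efficient M M-value i j i≢j in s , ⊆U s∈ , eff
        ; result? = U? }

solution : {G : Graph n} (m : ℕ) (Σ : Vector Strategy (suc m)) → (∀ ℓ i → IsReducing (Σ ℓ .op i)) →
  {p : ℕ} (P : Fin p → SepSet n) → (∀ i → IsKProfile G (suc m) (P i)) → Solution G m Σ P
solution zero Σ red P P-k = FirstLevel.first P P-k Σ red
solution {n = n} {G = G} (suc m) Σ red {p} P P-k =
  extend (solution m (init Σ) (λ ℓ → red _) _ (λ i → restrict-kProfile (P-k i) (n≤1+n _)))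
  where
  extend : Solution G m (init Σ) (λ i s → s ∈ P i × order s < suc m) → Solution G (suc m) Σ P
  extend lower = repackage (next {σ = last Σ} (red _))
    where
    module Lower = Solution lower
    open NextLevel P P-k Lower.system Lower.result? Lower.essential Lower.efficient

    repackage : Next {σ = last Σ} (red _) → Solution G (suc m) Σ P
    repackage x = record
      { result = result
      ; derivation = Lower.result , Lower.derivation , Lower.system , values , derivation , result≐
      ; system = system′ ; essential = essential′ ; efficient = efficient′ ; result? = result? }
      where open Next x

-- Graph isomorphisms

≅-sym : G ≅ G′ → G′ ≅ G
≅-sym {G′ = G′} φ = record
  { bijection = Perm.flip bijection
  ; preserves = λ u v → mk⇔
      (λ uv → Equivalence.from (preserves (φ⁻¹ u) (φ⁻¹ v))
        (subst₂ (Graph.Adj G′) (sym (strictlyInverseˡ u)) (sym (strictlyInverseˡ v)) uv))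
      (λ uv → subst₂ (Graph.Adj G′) (strictlyInverseˡ u) (strictlyInverseˡ v)
        (Equivalence.to (preserves (φ⁻¹ u) (φ⁻¹ v)) uv)) }
  where
  open _≅_ φ using (bijection; preserves)
  open Inverse bijection using (strictlyInverseˡ) renaming (from to φ⁻¹)

∈-image⁺ : (φ : G ≅ G′) {A : Subset _} {v : Fin _} → _≅_.from φ v V.∈ A → v V.∈ imageᵛ φ A
∈-image⁺ φ {A} {v} ∈A = Vec.lookup⇒[]= v _ (trans (Vec.lookup∘tabulate _ v) (Vec.[]=⇒lookup ∈A))

∈-image⁻ : (φ : G ≅ G′) {A : Subset _} {v : Fin _} → v V.∈ imageᵛ φ A → _≅_.from φ v V.∈ A
∈-image⁻ φ {A} {v} v∈ = Vec.lookup⇒[]= _ A (trans (sym (Vec.lookup∘tabulate _ v)) (Vec.[]=⇒lookup v∈))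

image-∩ : (φ : G ≅ G′) (A B : Subset _) → imageᵛ φ A V.∩ imageᵛ φ B ≡ imageᵛ φ (A V.∩ B)
image-∩ φ A B = V.⊆-antisym
  (λ v∈ → let (v∈A , v∈B) = V.x∈p∩q⁻ _ _ v∈ in
    ∈-image⁺ φ (V.x∈p∩q⁺ {p = A} {q = B} (∈-image⁻ φ v∈A , ∈-image⁻ φ v∈B)))
  (λ v∈ → let (v∈A , v∈B) = V.x∈p∩q⁻ A B (∈-image⁻ φ v∈) in
    V.x∈p∩q⁺ (∈-image⁺ φ v∈A , ∈-image⁺ φ v∈B))

-- Writes cardinality as a sum over vertices, to which invariance under reindexing by a bijection
-- applies.
indicator : Subset n → Fin n → ℕ
indicator A v = if lookup A v then 1 else 0

∣∣≡sum : (A : Subset n) → ∣ A ∣ ≡ sum (indicator A)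
∣∣≡sum []          = refl
∣∣≡sum (true  ∷ A) = cong suc (∣∣≡sum A)
∣∣≡sum (false ∷ A) = ∣∣≡sum A

∣image∣ : (φ : G ≅ G′) (A : Subset _) → ∣ imageᵛ φ A ∣ ≡ ∣ A ∣
∣image∣ φ A = begin
  ∣ imageᵛ φ A ∣                             ≡⟨ ∣∣≡sum (imageᵛ φ A) ⟩
  sum (indicator (imageᵛ φ A))               ≡⟨ sum-cong-≗ indicator-image ⟩
  sum (λ v → indicator A (_≅_.from φ v))     ≡⟨ sum-permute (indicator A) (Perm.flip (_≅_.bijection φ)) ⟨
  sum (indicator A)                          ≡⟨ ∣∣≡sum A ⟨
  ∣ A ∣                                      ∎
  where
  open ≡-Reasoning
  indicator-image : ∀ v → indicator (imageᵛ φ A) v ≡ indicator A (_≅_.from φ v)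
  indicator-image v = cong (if_then 1 else 0) (Vec.lookup∘tabulate _ v)

order-image : (φ : G ≅ G′) (s : Pair _) → order (imageᵛ φ (proj₁ s) , imageᵛ φ (proj₂ s)) ≡ order s
order-image φ (A , B) = trans (cong ∣_∣ (image-∩ φ A B)) (∣image∣ φ (A V.∩ B))

image-inverse : (φ : G ≅ G′) (A : Subset _) → imageᵛ (≅-sym φ) (imageᵛ φ A) ≡ A
image-inverse φ A = V.⊆-antisym
  (λ {v} v∈ → subst (V._∈ A) (strictlyInverseʳ v) (∈-image⁻ φ (∈-image⁻ (≅-sym φ) v∈)))
  (λ {v} v∈ → ∈-image⁺ (≅-sym φ) (∈-image⁺ φ (subst (V._∈ A) (sym (strictlyInverseʳ v)) v∈)))
  where open Inverse (_≅_.bijection φ) using (strictlyInverseʳ)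

image-separation : (φ : G ≅ G′) {s : Pair _} → s ∈ IsSeparation G →
  (imageᵛ φ (proj₁ s) , imageᵛ φ (proj₂ s)) ∈ IsSeparation G′
image-separation {G = G} φ {A , B} sep@(_ , none) =
  V.⊆-antisym V.⊆⊤ (λ {v} _ →
    V.x∈p∪q⁺ (Sum.map (∈-image⁺ φ) (∈-image⁺ φ) (separation-cover G sep (_≅_.from φ v)))) ,
  λ u∈ v∈ uv → none
    (V.x∈p∧x∉q⇒x∈p─q (∈-image⁻ φ (V.p─q⊆p _ _ u∈)) (x∈p─q⇒x∉q _ _ u∈ ∘ ∈-image⁺ φ))
    (V.x∈p∧x∉q⇒x∈p─q (∈-image⁻ φ (V.p─q⊆p _ _ v∈)) (x∈p─q⇒x∉q _ _ v∈ ∘ ∈-image⁺ φ))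
    (Equivalence.to (_≅_.preserves (≅-sym φ) _ _) uv)

transport : G ≅ G′ → Transport G G′
transport φ = record
  { toᵛ = imageᵛ φ ; fromᵛ = imageᵛ (≅-sym φ)
  ; from-toᵛ = image-inverse φ ; to-fromᵛ = image-inverse (≅-sym φ)
  ; toᵛ-mono = λ A⊆B v∈ → ∈-image⁺ φ (A⊆B (∈-image⁻ φ v∈))
  ; fromᵛ-mono = λ A⊆B v∈ → ∈-image⁺ (≅-sym φ) (A⊆B (∈-image⁻ (≅-sym φ) v∈))
  ; to-separation = image-separation φ ; from-separation = image-separation (≅-sym φ)
  ; order-to = order-image φ ; order-from = order-image (≅-sym φ) }

module _ (φ : G ≅ G′) where
  ≐image⇒∼ : {P : SepSet _} {P′ : SepSet _} → P′ ≐ image φ P → P ∼[ transport φ ] P′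
  ≐image⇒∼ {P} (P′⊆ , ⊆P′) = corr (λ s∈P → ⊆P′ (_ , _ , s∈P , refl , refl))
    λ s∈P′ → let (A , B , AB∈P , A≡ , B≡) = P′⊆ s∈P′ in
      subst P (trans (sym (from-to (transport φ) (A , B))) (cong (from (transport φ)) (cong₂ _,_ A≡ B≡))) AB∈P

  ∼⇒≐image : {P : SepSet _} {P′ : SepSet _} → P ∼[ transport φ ] P′ → P′ ≐ image φ P
  ∼⇒≐image c = (λ {(A , B)} s∈P′ → _ , _ , from∈ c s∈P′ , to-fromᵛ (transport φ) A , to-fromᵛ (transport φ) B) ,
                λ { (A , B , s∈P , refl , refl) → to∈ c s∈P }

  ≈image⇒∼ᶠ : {𝒫 : Family _} {𝒫′ : Family _} → 𝒫′ ≈ᶠ imageᶠ φ 𝒫 → 𝒫 ∼ᶠ[ transport φ ] 𝒫′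
  ≈image⇒∼ᶠ (f , g) = corrᶠ (λ i → let (j , eq) = g i in j , ≐image⇒∼ eq)
                             (λ j → let (i , eq) = f j in i , ≐image⇒∼ eq)

theorem4p4 : (m : ℕ) → let k = suc m in (Σ : KStrategy k) →
    (∀ {n} (G : Graph n) {p} (P : Fin p → SepSet n) → (∀ i → IsKProfile G k (P i)) →
    let 𝒫 = family (Fin p) P in
    ∃[ N ] NΣ G m (strategies Σ) 𝒫 N
    × IsNestedSystem G N
    × (∀ {s} → s ∈ N → s ∈ Essential G 𝒫 × order s < k)
    × EfficientlyDistinguishesAll G N 𝒫)
    ×
    (∀ {n n′} {G : Graph n} {G′ : Graph n′} (φ : G ≅ G′)
    {p p′} (P : Fin p → SepSet n) (P′ : Fin p′ → SepSet n′) →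
    (∀ i → IsKProfile G k (P i)) →
    let 𝒫 = family (Fin p) P
        𝒫′ = family (Fin p′) P′ in
    𝒫′ ≈ᶠ imageᶠ φ 𝒫 →
    ∀ {N N′} → NΣ G m (strategies Σ) 𝒫 N → NΣ G′ m (strategies Σ) 𝒫′ N′ →
    N′ ≐ image φ N)
theorem4p4 m Σ =
  (λ G P P-k → let open Solution (solution m (strategies Σ) (reducing Σ) P P-k) in
    result , derivation , system , essential , efficient) ,
  (λ φ P P′ _ 𝒫′≈ x y → ∼⇒≐image φ (NΣ-∼ m (strategies Σ) x y (≈image⇒∼ᶠ φ 𝒫′≈)))
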